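{- Let $P(x)=x^5+k_2x^3+k_3x^2+k_4x+k_5$ be a real polynomial with $P(x)\neq x^5$. Consider the following three cases: 1) $k_2<0$, $k_3<0$, $k_4=0$ and $k_5=k_2k_3$; 2) $k_2<0$, $k_3<0$, $0<k_4<\frac{k_2^2}{4}$ and $k_5=k_3\left(\frac{k_2}{2}-\sqrt{\frac{k_2^2}{4}-k_4}\right)$; 3) $k_2<0$, $k_3=0$, $k_4=\frac{k_2^2}{4}$ and $k_5=0$. If none of the cases 1), 2), 3) holds, then $P(x)$ is $\mathcal{R}$ if and only if $P(x)$ is $\mathcal{IR}$. If one of the cases 1), 2), 3) holds, then $P(x)$ is not $\mathcal{IR}$.
   Context: A monic real polynomial $P(x)$ of degree $n$ is realizable ($\mathcal{R}$) if it is the characteristic polynomial of some $n\times n$ entrywise nonnegative matrix; it is irreducibly realizable ($\mathcal{IR}$) if it is the characteristic polynomial of some $n\times n$ irreducible entrywise nonnegative matrix. A square matrix is irreducible if it is not similar by a permutation matrix to a nontrivially block triangular matrix (equivalently, its digraph is strongly connected). -}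

module Defs where

open import Level using (Level; _⊔_) renaming (suc to lsuc)
open import Algebra.Bundles using (CommutativeRing)
open import Algebra.Bundles.Raw using (RawRing)
import Algebra.Definitions.RawSemiring as RawSemiringDefinitions
open import Data.Fin.Base using (Fin; toℕ; punchIn)
open import Data.Fin.Permutation using (Permutation′; _⟨$⟩ʳ_)
open import Data.Fin.Properties using (_≟_)
open import Data.List.Base using (List; []; _∷_; map)
import Data.Nat.Base as ℕ
open import Data.Nat.Base using (ℕ; zero; suc)
open import Data.Product.Base using (Σ-syntax; ∃; ∃-syntax; _×_)
open import Data.Vec.Functional using (Vector)
open import Relation.Binary.Core using (Rel)
open import Relation.Binary.Structures using (IsDecTotalOrder)
import Relation.Binary.Construct.NonStrictToStrict as NonStrictToStrict
open import Relation.Nullary.Decidable using (yes; no)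
open import Relation.Nullary.Negation using (¬_)
open import Relation.Unary using (Pred)

-- The real numbers, given axiomatically as a Dedekind-complete ordered field
-- (classically unique up to isomorphism).  The order is decidable, as it is
-- for the classical reals.
record Reals (c ℓ₁ ℓ₂ : Level) : Set (lsuc (c ⊔ ℓ₁ ⊔ ℓ₂)) where
  field
    commutativeRing : CommutativeRing c ℓ₁

  open CommutativeRing commutativeRing public
    using (Carrier; _≈_; _+_; _*_; -_; _-_; 0#; 1#; rawRing)

  infix 8 _⁻¹
  infix 4 _≤_

  field
    -- Total, but unconstrained at 0#.
    _⁻¹             : Carrier → Carrier
    _≤_             : Rel Carrier ℓ₂
    0≉1             : ¬ (0# ≈ 1#)
    *-inverseʳ      : ∀ x → ¬ (x ≈ 0#) → x * x ⁻¹ ≈ 1#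
    isDecTotalOrder : IsDecTotalOrder _≈_ _≤_
    +-monoʳ-≤       : ∀ z {x y} → x ≤ y → z + x ≤ z + y
    *-nonNeg        : ∀ {x y} → 0# ≤ x → 0# ≤ y → 0# ≤ x * y

  UpperBound : ∀ {ℓ} → Pred Carrier ℓ → Carrier → Set (c ⊔ ℓ₂ ⊔ ℓ)
  UpperBound S u = ∀ {x} → S x → x ≤ u

  LeastUpperBound : ∀ {ℓ} → Pred Carrier ℓ → Carrier → Set (c ⊔ ℓ₂ ⊔ ℓ)
  LeastUpperBound S u = UpperBound S u × (∀ {v} → UpperBound S v → u ≤ v)

  field
    complete : (S : Pred Carrier (c ⊔ ℓ₁ ⊔ ℓ₂)) →
               ∃ S → ∃ (UpperBound S) → ∃ (LeastUpperBound S)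

  open NonStrictToStrict _≈_ _≤_ public using (_<_)

  infixl 7 _/_
  _/_ : Carrier → Carrier → Carrier
  x / y = x * y ⁻¹

  2# 4# : Carrier
  2# = 1# + 1#
  4# = 2# + 2#

  -- r = √ x
  IsSqrt : Carrier → Carrier → Set (ℓ₁ ⊔ ℓ₂)
  IsSqrt x r = 0# ≤ r × r * r ≈ x

module SquareMatrices {c ℓ} (R : RawRing c ℓ) where
  open RawRing R
  open RawSemiringDefinitions rawSemiring using (sum; _^_)

  Matrix : ℕ → Set c
  Matrix n = Fin n → Fin n → Carrier

  minor : ∀ {n} → Matrix (suc n) → Fin (suc n) → Matrix n
  minor A j i k = A (Fin.suc i) (punchIn j k)

  -- Laplace expansion along the first row.
  det : ∀ {n} → Matrix n → Carrier
  det {zero}  A = 1#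
  det {suc n} A =
    sum λ j → (- 1#) ^ toℕ j * (A Fin.zero j * det (minor A j))

-- Polynomials in one variable: the list of coefficients, constant term first.
-- Trailing zeros are allowed, so equality is equality of all coefficients.
module Polynomials {c ℓ} (R : RawRing c ℓ) where
  open RawRing R

  Poly : Set c
  Poly = List Carrier

  coeff : Poly → ℕ → Carrier
  coeff []      _       = 0#
  coeff (a ∷ p) zero    = a
  coeff (a ∷ p) (suc i) = coeff p i

  infix  4 _≈ₚ_
  infixl 6 _+ₚ_
  infixl 7 _*ₚ_

  _≈ₚ_ : Rel Poly ℓ
  p ≈ₚ q = ∀ i → coeff p i ≈ coeff q i

  _+ₚ_ : Poly → Poly → Poly
  []      +ₚ q       = q
  (a ∷ p) +ₚ []      = a ∷ p
  (a ∷ p) +ₚ (b ∷ q) = a + b ∷ p +ₚ q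

  _*ₚ_ : Poly → Poly → Poly
  []      *ₚ q = []
  (a ∷ p) *ₚ q = map (a *_) q +ₚ (0# ∷ p *ₚ q)

  const : Carrier → Poly
  const a = a ∷ []

  X : Poly
  X = 0# ∷ 1# ∷ []

  polyRawRing : RawRing c ℓ
  polyRawRing = record
    { Carrier = Poly
    ; _≈_     = _≈ₚ_
    ; _+_     = _+ₚ_
    ; _*_     = _*ₚ_
    ; -_      = map (-_)
    ; 0#      = []
    ; 1#      = const 1#
    }

  open SquareMatrices R using (Matrix)
  open SquareMatrices polyRawRing using (det) renaming (Matrix to PolyMatrix)

  -- x I − A
  charMatrix : ∀ {n} → Matrix n → PolyMatrix n
  charMatrix A i j with i ≟ j
  ... | yes _ = X +ₚ const (- A i j)
  ... | no  _ = const (- A i j)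

  charPoly : ∀ {n} → Matrix n → Poly
  charPoly A = det (charMatrix A)

module Realizability {c ℓ₁ ℓ₂} (ℝ : Reals c ℓ₁ ℓ₂) where
  open Reals ℝ
  open SquareMatrices rawRing public using (Matrix)
  open Polynomials rawRing public using (Poly; _≈ₚ_; charPoly)

  NonNegative : ∀ {n} → Matrix n → Set ℓ₂
  NonNegative A = ∀ i j → 0# ≤ A i j

  -- Conjugating by a permutation matrix relabels rows and columns
  -- simultaneously; the lower left (n − m) × m block must vanish.
  Reducible : ∀ {n} → Matrix n → Set ℓ₁
  Reducible {n} A =
    Σ[ π ∈ Permutation′ n ] Σ[ m ∈ ℕ ] 0 ℕ.< m × m ℕ.< n ×
      (∀ i j → m ℕ.≤ toℕ i → toℕ j ℕ.< m → A (π ⟨$⟩ʳ i) (π ⟨$⟩ʳ j) ≈ 0#)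

  Irreducible : ∀ {n} → Matrix n → Set ℓ₁
  Irreducible A = ¬ Reducible A

  -- Here n is the degree of the monic polynomial P.
  Realizable : ℕ → Poly → Set (c ⊔ ℓ₁ ⊔ ℓ₂)
  Realizable n P = Σ[ A ∈ Matrix n ] NonNegative A × charPoly A ≈ₚ P

  IrreduciblyRealizable : ℕ → Poly → Set (c ⊔ ℓ₁ ⊔ ℓ₂)
  IrreduciblyRealizable n P =
    Σ[ A ∈ Matrix n ] NonNegative A × Irreducible A × charPoly A ≈ₚ P

  -- x⁵ + k₂ x³ + k₃ x² + k₄ x + k₅
  quintic : (k₂ k₃ k₄ k₅ : Carrier) → Poly
  quintic k₂ k₃ k₄ k₅ = k₅ ∷ k₄ ∷ k₃ ∷ k₂ ∷ 0# ∷ 1# ∷ []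

  x⁵ : Poly
  x⁵ = 0# ∷ 0# ∷ 0# ∷ 0# ∷ 0# ∷ 1# ∷ []

  Case1 Case3 : (k₂ k₃ k₄ k₅ : Carrier) → Set (ℓ₁ ⊔ ℓ₂)
  Case1 k₂ k₃ k₄ k₅ = k₂ < 0# × k₃ < 0# × k₄ ≈ 0# × k₅ ≈ k₂ * k₃
  Case3 k₂ k₃ k₄ k₅ = k₂ < 0# × k₃ ≈ 0# × k₄ ≈ (k₂ * k₂) / 4# × k₅ ≈ 0#

  -- The bound k₄ < k₂² / 4 makes the radicand positive.
  Case2 : (k₂ k₃ k₄ k₅ : Carrier) → Set (c ⊔ ℓ₁ ⊔ ℓ₂)
  Case2 k₂ k₃ k₄ k₅ =
    k₂ < 0# × k₃ < 0# × 0# < k₄ × k₄ < (k₂ * k₂) / 4# ×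
    (∃[ r ] IsSqrt ((k₂ * k₂) / 4# - k₄) r × k₅ ≈ k₃ * (k₂ / 2# - r))

{-# OPTIONS --safe #-}
module Submission where

-- For a nonnegative 5 × 5 matrix with zero diagonal let w run over the weights
-- of the 2-cycles and T over those of the 3-cycles, so that −k₂ = p = Σ w and
-- −k₃ = q = Σ T, while k₄ = D − f and k₅ = E − g: here D sums w w′ over disjoint
-- 2-cycles, E sums w T over disjoint 2- and 3-cycles, and f, g ≥ 0 are the
-- weights of the 4- and 5-cycles.
--
-- Let w₀ be the largest w; then E ≤ w₀ q.  If w₀ ≥ a ≥ p/2 then D ≤ a (p − a),
-- and in any case D ≤ p²/4 (Motzkin–Straus for the Petersen graph, whose
-- vertices are the edges of K₅).  Hence a realizable P satisfies
-- P = (x² − a)(x³ − b x − q) − f x − g with 0 ≤ b ≤ a and q, f, g ≥ 0.  Three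
-- sparse matrices realize all of these irreducibly unless f = g = 0 and either
-- b < a and q > 0 (cases 1 and 2) or b = a and q = 0 (case 3).
--
-- In the exceptional cases all the estimates are equalities.  Then every cycle
-- meeting both the 2-cycle of weight w₀ and its complement has weight zero, so
-- no arc between the two blocks lies on a cycle and the matrix is reducible.

-- The product (x² - a)(x³ - b x - q) belongs to a block matrix, a 2-cycle of weight a beside a 3 ×
-- 3 block, so the estimates say that reducible matrices make k₄ and k₅ as large as possible. The
-- difficulty is that one and the same a must serve both coefficients: the bound on k₅ needs a ≥ w₀,
-- the heavy-edge bound on k₄ needs p/2 ≤ a ≤ w₀. Hence a = w₀ when w₀ ≥ p/2, and a = p/2 with the
-- Motzkin-Straus bound otherwise. The exceptional cases need the estimates with explicit
-- remainders. This is why squares are subtracted in `excess` and why the Motzkin-Straus bound is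
-- obtained from an identity with two nonnegative remainders, `deviation` and `defect`. No general
-- theory of determinants is used. Facts about characteristic polynomials are computed once for a
-- symbolic 5 × 5 matrix and carried over to the reals; many inequalities are read off from an
-- expansion in which only plus signs survive.

open import Defs
open import Algebra.Bundles using (CommutativeRing)
open import Algebra.Bundles.Raw using (RawRing)
import Algebra.Definitions.RawSemiring as RawSemiringDefinitions
import Algebra.Properties.CommutativeSemigroup as CommutativeSemigroupProperties
import Algebra.Properties.Ring as RingProperties
open import Data.Bool.Base using (Bool; true; false; T; _∧_; _xor_; not)
open import Data.Bool.ListAction using (all)
open import Data.Bool.Properties using (T-∧)
open import Data.Empty using (⊥)
open import Data.Fin.Base using (Fin; zero; suc; toℕ; fromℕ<; punchIn)
open import Data.Fin.Patterns
open import Data.Fin.Permutation as Permutation using (Permutation′; _⟨$⟩ʳ_; _⟨$⟩ˡ_; _∘ₚ_; transpose)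
import Data.Fin.Properties as Fin
open import Data.List.Base using (List; []; _∷_; map; null)
open import Data.List.Relation.Binary.Pointwise.Base using (Pointwise; []; _∷_)
open import Data.List.Relation.Unary.All as All using (All; []; _∷_)
open import Data.List.Relation.Unary.All.Properties using (all⁺)
open import Data.Nat.Base as ℕ using (ℕ; zero; suc; z≤n; s≤s; _<ᵇ_; _≡ᵇ_)
open import Data.Nat.DivMod using (_mod_) renaming (_/_ to _÷_)
import Data.Nat.Properties as ℕ
open import Data.Product.Base using (_×_; _,_; proj₁; proj₂; ∃; ∃-syntax; Σ-syntax)
open import Data.Product.Properties using (≡-dec)
open import Data.Sum.Base using (_⊎_; inj₁; inj₂)
open import Data.Unit.Base using (tt)
open import Function.Bundles using (_⇔_; mk⇔; Equivalence)
open import Level using (0ℓ; _⊔_) renaming (suc to lsuc)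
open import Relation.Binary.Construct.Closure.ReflexiveTransitive using (Star; ε; _◅_; _◅◅_)
open import Relation.Binary.PropositionalEquality as ≡ using (_≡_; _≢_; refl)
open import Relation.Binary.Structures using (IsDecTotalOrder)
open import Relation.Nullary.Decidable
  using (Dec; yes; no; from-yes; decidable-stable; ¬?; _→-dec_; _×-dec_)
open import Relation.Nullary.Negation using (¬_; contradiction)

-- Symbolic polynomials

Monomial : Set
Monomial = List ℕ

Term : Set
Term = Bool × Monomial

-- A coefficient n is stored as n copies of the monomial, with signs, so that no
-- coefficient ring is needed.
Form : Set
Form = List Term

-- Only equality carries evidence, because soundness needs nothing else; the order merely brings
-- like terms together.
data Comparison {A : Set} (x y : A) : Set where
  before : Comparison x y
  same   : x ≡ y → Comparison x y
  after  : Comparison x y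

compareℕ : ∀ m n → Comparison m n
compareℕ m n with m ≡ᵇ n in eq
... | true = same (ℕ.≡ᵇ⇒≡ m n (≡.subst T (≡.sym eq) tt))
... | false with m <ᵇ n
...   | true  = before
...   | false = after

-- A proper prefix comes last, which makes the order compatible with products.
compareMonomial : (m n : Monomial) → Comparison m n
compareMonomial []      []      = same refl
compareMonomial []      (_ ∷ _) = after
compareMonomial (_ ∷ _) []      = before
compareMonomial (x ∷ m) (y ∷ n) with compareℕ x y
... | before = before
... | after  = after
... | same refl with compareMonomial m n
...   | before    = before
...   | after     = after
...   | same refl = same refl

infixl 6 _⊕_
infixl 7 _⊗_

mutual
  _⊕_ : Form → Form → Form
  []            ⊕ q = q
  ((s , m) ∷ p) ⊕ q = insert s m p q

  -- The first term of the left summand is passed in pieces, which makes the mutual recursion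
  -- structurally decreasing.
  insert : Bool → Monomial → Form → Form → Form
  insert s m p []            = (s , m) ∷ p
  insert s m p ((t , n) ∷ q) with compareMonomial m n
  ... | before = (s , m) ∷ (p ⊕ ((t , n) ∷ q))
  ... | after  = (t , n) ∷ insert s m p q
  ... | same _ with s xor t
  ...   | true  = p ⊕ q
  ...   | false = (s , m) ∷ (t , n) ∷ (p ⊕ q)

insertVar : ℕ → Monomial → Monomial
insertVar x []      = x ∷ []
insertVar x (y ∷ m) with x <ᵇ y
... | true  = x ∷ y ∷ m
... | false = y ∷ insertVar x m

_⊙_ : Monomial → Monomial → Monomial
[]      ⊙ n = n
(x ∷ m) ⊙ n = insertVar x (m ⊙ n)

-- Multiplication by a monomial preserves the order of the terms, so nothing is sorted again. As
-- `true` stands for plus, the sign of a product is the negated exclusive or.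
scale : Bool → Monomial → Form → Form
scale s m []            = []
scale s m ((t , n) ∷ q) = (not (s xor t) , m ⊙ n) ∷ scale s m q

_⊗_ : Form → Form → Form
[]            ⊗ q = []
((s , m) ∷ p) ⊗ q = scale s m q ⊕ (p ⊗ q)

⊖_ : Form → Form
⊖ []            = []
⊖ ((s , m) ∷ p) = (not s , m) ∷ ⊖ p

one : Form
one = (true , []) ∷ []

var : ℕ → Form
var x = (true , x ∷ []) ∷ []

formRawRing : RawRing 0ℓ 0ℓ
formRawRing = record
  { Carrier = Form ; _≈_ = _≡_ ; _+_ = _⊕_ ; _*_ = _⊗_ ; -_ = ⊖_ ; 0# = [] ; 1# = one }

positive : Form → Bool
positive []            = true
positive ((s , _) ∷ p) = s ∧ positive p

infixl 6 _:+_ _⊟_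
infixl 7 _:*_
infix 8 :-_

-- Expressions evaluate definitionally, which forms do not; a form occurs in an
-- expression as an opaque constant.
data Expr : Set where
  :var       : ℕ → Expr
  :form      : Form → Expr
  _:+_ _:*_  : Expr → Expr → Expr
  :-_        : Expr → Expr
  :0 :1      : Expr

_⊟_ : Expr → Expr → Expr
d ⊟ e = d :+ :- e

v₀ v₁ v₂ v₃ : Expr
v₀ = :var 0
v₁ = :var 1
v₂ = :var 2
v₃ = :var 3

exprRawRing : RawRing 0ℓ 0ℓ
exprRawRing = record
  { Carrier = Expr ; _≈_ = _≡_ ; _+_ = _:+_ ; _*_ = _:*_ ; -_ = :-_ ; 0# = :0 ; 1# = :1 }

normalise : Expr → Form
normalise (:var x)  = var x
normalise (:form p) = p
normalise (d :+ e)  = normalise d ⊕ normalise e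
normalise (d :* e)  = normalise d ⊗ normalise e
normalise (:- e)    = ⊖ normalise e
normalise :0        = []
normalise :1        = one

module Evaluation {c ℓ} (R : CommutativeRing c ℓ) where
  open CommutativeRing R renaming (refl to ≈-refl)
  open RingProperties ring
  open CommutativeSemigroupProperties +-commutativeSemigroup
    using (x∙yz≈y∙xz; interchange)
  open CommutativeSemigroupProperties *-commutativeSemigroup using ()
    renaming (x∙yz≈y∙xz to x*yz≈y*xz; interchange to *-interchange)
  open import Relation.Binary.Reasoning.Setoid setoid

  signed : Bool → Carrier → Carrier
  signed true  x = x
  signed false x = - x

  signed-opposite : ∀ s t x → (s xor t) ≡ true → signed s x + signed t x ≈ 0#
  signed-opposite true  false x _ = -‿inverseʳ x
  signed-opposite false true  x _ = -‿inverseˡ x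

  signed-* : ∀ s t x y → signed (not (s xor t)) (x * y) ≈ signed s x * signed t y
  signed-* true  true  x y = ≈-refl
  signed-* true  false x y = -‿distribʳ-* x y
  signed-* false true  x y = -‿distribˡ-* x y
  signed-* false false x y = begin
    x * y         ≈⟨ -‿involutive (x * y) ⟨
    - - (x * y)   ≈⟨ -‿cong (-‿distribʳ-* x y) ⟩
    - (x * - y)   ≈⟨ -‿distribˡ-* x (- y) ⟩
    - x * - y     ∎

  signed-cong : ∀ s {x y} → x ≈ y → signed s x ≈ signed s y
  signed-cong true  eq = eq
  signed-cong false eq = -‿cong eq

  module _ (ρ : ℕ → Carrier) where

    ⟦_⟧ₘ : Monomial → Carrier
    ⟦ []    ⟧ₘ = 1#
    ⟦ x ∷ m ⟧ₘ = ρ x * ⟦ m ⟧ₘ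

    ⟦_⟧ᶠ : Form → Carrier
    ⟦ []          ⟧ᶠ = 0#
    ⟦ (s , m) ∷ p ⟧ᶠ = signed s ⟦ m ⟧ₘ + ⟦ p ⟧ᶠ

    ⟦_⟧ : Expr → Carrier
    ⟦ :var x  ⟧ = ρ x
    ⟦ :form p ⟧ = ⟦ p ⟧ᶠ
    ⟦ d :+ e  ⟧ = ⟦ d ⟧ + ⟦ e ⟧
    ⟦ d :* e  ⟧ = ⟦ d ⟧ * ⟦ e ⟧
    ⟦ :- e    ⟧ = - ⟦ e ⟧
    ⟦ :0      ⟧ = 0#
    ⟦ :1      ⟧ = 1#

    mutual
      ⊕-sound : ∀ p q → ⟦ p ⊕ q ⟧ᶠ ≈ ⟦ p ⟧ᶠ + ⟦ q ⟧ᶠ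
      ⊕-sound []            q = sym (+-identityˡ _)
      ⊕-sound ((s , m) ∷ p) q = insert-sound s m p q

      insert-sound : ∀ s m p q → ⟦ insert s m p q ⟧ᶠ ≈ (signed s ⟦ m ⟧ₘ + ⟦ p ⟧ᶠ) + ⟦ q ⟧ᶠ
      insert-sound s m p [] = sym (+-identityʳ _)
      insert-sound s m p ((t , n) ∷ q) with compareMonomial m n
      ... | before = trans (+-congˡ (⊕-sound p _)) (sym (+-assoc _ _ _))
      ... | after  = trans (+-congˡ (insert-sound s m p q)) (x∙yz≈y∙xz _ _ _)
      ... | same refl with s xor t in eq
      ...   | true  = begin
        ⟦ p ⊕ q ⟧ᶠ                                               ≈⟨ ⊕-sound p q ⟩
        ⟦ p ⟧ᶠ + ⟦ q ⟧ᶠ                                          ≈⟨ +-identityˡ _ ⟨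
        0# + (⟦ p ⟧ᶠ + ⟦ q ⟧ᶠ)                                   ≈⟨ +-congʳ (signed-opposite s t _ eq) ⟨
        (signed s ⟦ m ⟧ₘ + signed t ⟦ m ⟧ₘ) + (⟦ p ⟧ᶠ + ⟦ q ⟧ᶠ)  ≈⟨ interchange _ _ _ _ ⟩
        (signed s ⟦ m ⟧ₘ + ⟦ p ⟧ᶠ) + (signed t ⟦ m ⟧ₘ + ⟦ q ⟧ᶠ)  ∎
      ...   | false = begin
        signed s ⟦ m ⟧ₘ + (signed t ⟦ m ⟧ₘ + ⟦ p ⊕ q ⟧ᶠ)         ≈⟨ +-assoc _ _ _ ⟨
        (signed s ⟦ m ⟧ₘ + signed t ⟦ m ⟧ₘ) + ⟦ p ⊕ q ⟧ᶠ         ≈⟨ +-congˡ (⊕-sound p q) ⟩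
        (signed s ⟦ m ⟧ₘ + signed t ⟦ m ⟧ₘ) + (⟦ p ⟧ᶠ + ⟦ q ⟧ᶠ)  ≈⟨ interchange _ _ _ _ ⟩
        (signed s ⟦ m ⟧ₘ + ⟦ p ⟧ᶠ) + (signed t ⟦ m ⟧ₘ + ⟦ q ⟧ᶠ)  ∎

    insertVar-sound : ∀ x m → ⟦ insertVar x m ⟧ₘ ≈ ρ x * ⟦ m ⟧ₘ
    insertVar-sound x []      = ≈-refl
    insertVar-sound x (y ∷ m) with x <ᵇ y
    ... | true  = ≈-refl
    ... | false = trans (*-congˡ (insertVar-sound x m)) (x*yz≈y*xz _ _ _)

    ⊙-sound : ∀ m n → ⟦ m ⊙ n ⟧ₘ ≈ ⟦ m ⟧ₘ * ⟦ n ⟧ₘ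
    ⊙-sound []      n = sym (*-identityˡ _)
    ⊙-sound (x ∷ m) n = begin
      ⟦ insertVar x (m ⊙ n) ⟧ₘ    ≈⟨ insertVar-sound x (m ⊙ n) ⟩
      ρ x * ⟦ m ⊙ n ⟧ₘ            ≈⟨ *-congˡ (⊙-sound m n) ⟩
      ρ x * (⟦ m ⟧ₘ * ⟦ n ⟧ₘ)     ≈⟨ *-assoc _ _ _ ⟨
      ρ x * ⟦ m ⟧ₘ * ⟦ n ⟧ₘ       ∎

    scale-sound : ∀ s m q → ⟦ scale s m q ⟧ᶠ ≈ signed s ⟦ m ⟧ₘ * ⟦ q ⟧ᶠ
    scale-sound s m []            = sym (zeroʳ _)
    scale-sound s m ((t , n) ∷ q) = begin
      signed (not (s xor t)) ⟦ m ⊙ n ⟧ₘ + ⟦ scale s m q ⟧ᶠ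
        ≈⟨ +-cong (signed-cong (not (s xor t)) (⊙-sound m n)) (scale-sound s m q) ⟩
      signed (not (s xor t)) (⟦ m ⟧ₘ * ⟦ n ⟧ₘ) + signed s ⟦ m ⟧ₘ * ⟦ q ⟧ᶠ
        ≈⟨ +-congʳ (signed-* s t _ _) ⟩
      signed s ⟦ m ⟧ₘ * signed t ⟦ n ⟧ₘ + signed s ⟦ m ⟧ₘ * ⟦ q ⟧ᶠ
        ≈⟨ distribˡ _ _ _ ⟨
      signed s ⟦ m ⟧ₘ * (signed t ⟦ n ⟧ₘ + ⟦ q ⟧ᶠ) ∎

    ⊗-sound : ∀ p q → ⟦ p ⊗ q ⟧ᶠ ≈ ⟦ p ⟧ᶠ * ⟦ q ⟧ᶠ
    ⊗-sound []            q = sym (zeroˡ _)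
    ⊗-sound ((s , m) ∷ p) q = begin
      ⟦ scale s m q ⊕ p ⊗ q ⟧ᶠ                        ≈⟨ ⊕-sound (scale s m q) (p ⊗ q) ⟩
      ⟦ scale s m q ⟧ᶠ + ⟦ p ⊗ q ⟧ᶠ                   ≈⟨ +-cong (scale-sound s m q) (⊗-sound p q) ⟩
      signed s ⟦ m ⟧ₘ * ⟦ q ⟧ᶠ + ⟦ p ⟧ᶠ * ⟦ q ⟧ᶠ      ≈⟨ distribʳ _ _ _ ⟨
      (signed s ⟦ m ⟧ₘ + ⟦ p ⟧ᶠ) * ⟦ q ⟧ᶠ             ∎

    signed-not : ∀ s x → signed (not s) x ≈ - signed s x
    signed-not true  x = ≈-refl
    signed-not false x = sym (-‿involutive x)

    ⊖-sound : ∀ p → ⟦ ⊖ p ⟧ᶠ ≈ - ⟦ p ⟧ᶠ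
    ⊖-sound []            = sym -0#≈0#
    ⊖-sound ((s , m) ∷ p) = trans (+-cong (signed-not s _) (⊖-sound p)) (-‿+-comm _ _)

    one-sound : ⟦ one ⟧ᶠ ≈ 1#
    one-sound = +-identityʳ 1#

    var-sound : ∀ x → ⟦ var x ⟧ᶠ ≈ ρ x
    var-sound x = trans (+-identityʳ _) (*-identityʳ _)

    normalise-sound : ∀ e → ⟦ normalise e ⟧ᶠ ≈ ⟦ e ⟧
    normalise-sound (:var x)  = var-sound x
    normalise-sound (:form p) = ≈-refl
    normalise-sound (d :+ e)  =
      trans (⊕-sound (normalise d) (normalise e)) (+-cong (normalise-sound d) (normalise-sound e))
    normalise-sound (d :* e)  =
      trans (⊗-sound (normalise d) (normalise e)) (*-cong (normalise-sound d) (normalise-sound e))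
    normalise-sound (:- e)    = trans (⊖-sound (normalise e)) (-‿cong (normalise-sound e))
    normalise-sound :0        = ≈-refl
    normalise-sound :1        = one-sound

    solve : ∀ d e → normalise d ≡ normalise e → ⟦ d ⟧ ≈ ⟦ e ⟧
    solve d e eq = begin
      ⟦ d ⟧                ≈⟨ normalise-sound d ⟨
      ⟦ normalise d ⟧ᶠ     ≡⟨ ≡.cong ⟦_⟧ᶠ eq ⟩
      ⟦ normalise e ⟧ᶠ     ≈⟨ normalise-sound e ⟩
      ⟦ e ⟧                ∎

    null-sound : ∀ p → T (null p) → ⟦ p ⟧ᶠ ≈ 0#
    null-sound [] _ = ≈-refl

    form-identity : ∀ p e → T (null (p ⊕ (⊖ normalise e))) → ⟦ p ⟧ᶠ ≈ ⟦ e ⟧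
    form-identity p e h = x∙y⁻¹≈ε⇒x≈y _ _ (begin
      ⟦ p ⟧ᶠ - ⟦ e ⟧               ≈⟨ normalise-sound (:form p :+ (:- e)) ⟨
      ⟦ p ⊕ (⊖ normalise e) ⟧ᶠ     ≈⟨ null-sound (p ⊕ (⊖ normalise e)) h ⟩
      0#                           ∎)

-- Characteristic polynomials of symbolic matrices

-- The characteristic polynomial uses raw ring operations only, so it is parametric in the ring:
-- related matrices have related coefficients. A relation suffices here, and no ring laws have to be
-- proved for forms.
record RingRelation {a b ℓ₁ ℓ₂} (R : RawRing a ℓ₁) (S : RawRing b ℓ₂) r :
    Set (lsuc r ⊔ a ⊔ b) where
  private
    module R = RawRing R
    module S = RawRing S
  infix 4 _∼_
  field
    _∼_ : R.Carrier → S.Carrier → Set r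
    +-∼ : ∀ {x y u v} → x ∼ u → y ∼ v → (x R.+ y) ∼ (u S.+ v)
    *-∼ : ∀ {x y u v} → x ∼ u → y ∼ v → (x R.* y) ∼ (u S.* v)
    -‿∼ : ∀ {x u} → x ∼ u → (R.- x) ∼ (S.- u)
    0-∼ : R.0# ∼ S.0#
    1-∼ : R.1# ∼ S.1#

module _ {a b ℓ₁ ℓ₂ r} {R : RawRing a ℓ₁} {S : RawRing b ℓ₂} (rel : RingRelation R S r) where
  open RingRelation rel
  private
    module R = RawRing R
    module S = RawRing S
    module RM = SquareMatrices R
    module SM = SquareMatrices S
    module RP = Polynomials R
    module SP = Polynomials S
    open RawSemiringDefinitions R.rawSemiring using () renaming (sum to sumᴿ; _^_ to _^ᴿ_)
    open RawSemiringDefinitions S.rawSemiring using () renaming (sum to sumˢ; _^_ to _^ˢ_)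

  sum-∼ : ∀ {n} {f : Fin n → R.Carrier} {g : Fin n → S.Carrier} →
          (∀ i → f i ∼ g i) → sumᴿ f ∼ sumˢ g
  sum-∼ {zero}  _ = 0-∼
  sum-∼ {suc n} h = +-∼ (h zero) (sum-∼ λ i → h (suc i))

  ^-∼ : ∀ {x u} n → x ∼ u → (x ^ᴿ n) ∼ (u ^ˢ n)
  ^-∼ zero    h = 1-∼
  ^-∼ (suc n) h = *-∼ h (^-∼ n h)

  det-∼ : ∀ {n} {A : RM.Matrix n} {B : SM.Matrix n} →
          (∀ i j → A i j ∼ B i j) → RM.det A ∼ SM.det B
  det-∼ {zero}  _ = 1-∼
  det-∼ {suc n} h = sum-∼ λ j →
    *-∼ (^-∼ (toℕ j) (-‿∼ 1-∼)) (*-∼ (h zero j) (det-∼ λ i k → h (suc i) (punchIn j k)))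

  +ₚ-∼ : ∀ {p q f g} → Pointwise _∼_ p f → Pointwise _∼_ q g → Pointwise _∼_ (p RP.+ₚ q) (f SP.+ₚ g)
  +ₚ-∼ []       ks       = ks
  +ₚ-∼ (h ∷ hs) []       = h ∷ hs
  +ₚ-∼ (h ∷ hs) (k ∷ ks) = +-∼ h k ∷ +ₚ-∼ hs ks

  scale-∼ : ∀ {x u q g} → x ∼ u → Pointwise _∼_ q g →
            Pointwise _∼_ (map (x R.*_) q) (map (u S.*_) g)
  scale-∼ h []       = []
  scale-∼ h (k ∷ ks) = *-∼ h k ∷ scale-∼ h ks

  *ₚ-∼ : ∀ {p q f g} → Pointwise _∼_ p f → Pointwise _∼_ q g → Pointwise _∼_ (p RP.*ₚ q) (f SP.*ₚ g)
  *ₚ-∼ []       ks = []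
  *ₚ-∼ (h ∷ hs) ks = +ₚ-∼ (scale-∼ h ks) (0-∼ ∷ *ₚ-∼ hs ks)

  -ₚ-∼ : ∀ {p f} → Pointwise _∼_ p f → Pointwise _∼_ (map R.-_ p) (map S.-_ f)
  -ₚ-∼ []       = []
  -ₚ-∼ (h ∷ hs) = -‿∼ h ∷ -ₚ-∼ hs

  polyRelation : RingRelation RP.polyRawRing SP.polyRawRing (b ⊔ a ⊔ r)
  polyRelation = record
    { _∼_ = Pointwise _∼_ ; +-∼ = +ₚ-∼ ; *-∼ = *ₚ-∼ ; -‿∼ = -ₚ-∼ ; 0-∼ = [] ; 1-∼ = 1-∼ ∷ [] }

  charMatrix-∼ : ∀ {n} {A : RM.Matrix n} {B : SM.Matrix n} → (∀ i j → A i j ∼ B i j) →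
                 ∀ i j → Pointwise _∼_ (RP.charMatrix A i j) (SP.charMatrix B i j)
  charMatrix-∼ h i j with i Fin.≟ j
  ... | yes _ = +ₚ-∼ (0-∼ ∷ 1-∼ ∷ []) (-‿∼ (h i j) ∷ [])
  ... | no  _ = -‿∼ (h i j) ∷ []

  coeff-∼ : ∀ {p f} → Pointwise _∼_ p f → ∀ i → RP.coeff p i ∼ SP.coeff f i
  coeff-∼ []       i       = 0-∼
  coeff-∼ (h ∷ hs) zero    = h
  coeff-∼ (h ∷ hs) (suc i) = coeff-∼ hs i

module _ {a b ℓ₁ ℓ₂ r} {R : RawRing a ℓ₁} {S : RawRing b ℓ₂} (rel : RingRelation R S r) where
  open RingRelation rel

  charPoly-∼ : ∀ {n} (A : SquareMatrices.Matrix R n) (B : SquareMatrices.Matrix S n) →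
               (∀ i j → A i j ∼ B i j) →
               Pointwise _∼_ (Polynomials.charPoly R A) (Polynomials.charPoly S B)
  charPoly-∼ A B h = det-∼ (polyRelation rel)
    {A = Polynomials.charMatrix R A} {B = Polynomials.charMatrix S B}
    (charMatrix-∼ rel {A = A} {B = B} h)

-- Conversion checking must never unfold a 5 × 5 determinant over an abstract
-- ring, so characteristic polynomials are sealed and used through this equation.
opaque
  sealed : ∀ {a ℓ} (R : RawRing a ℓ) {n} (A : SquareMatrices.Matrix R n) →
           ∃ λ p → p ≡ Polynomials.charPoly R A
  sealed R A = Polynomials.charPoly R A , refl

charCoeff : ∀ {a ℓ} (R : RawRing a ℓ) {n} → SquareMatrices.Matrix R n → ℕ → RawRing.Carrier R
charCoeff R A = Polynomials.coeff R (proj₁ (sealed R A))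

module Transfer {c ℓ} (R : CommutativeRing c ℓ) where
  open CommutativeRing R renaming (refl to ≈-refl)
  open Evaluation R

  formRelation : (ρ : ℕ → Carrier) → RingRelation rawRing formRawRing ℓ
  formRelation ρ = record
    { _∼_ = λ x p → x ≈ ⟦_⟧ᶠ ρ p
    ; +-∼ = λ {_} {_} {p} {q} h k → trans (+-cong h k) (sym (⊕-sound ρ p q))
    ; *-∼ = λ {_} {_} {p} {q} h k → trans (*-cong h k) (sym (⊗-sound ρ p q))
    ; -‿∼ = λ {_} {p} h → trans (-‿cong h) (sym (⊖-sound ρ p))
    ; 0-∼ = ≈-refl
    ; 1-∼ = sym (one-sound ρ)
    }

  charCoeff-eval : ∀ ρ {n} (A : SquareMatrices.Matrix rawRing n) (S : SquareMatrices.Matrix formRawRing n) →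
    (∀ i j → A i j ≈ ⟦_⟧ᶠ ρ (S i j)) →
    ∀ k → charCoeff rawRing A k ≈ ⟦_⟧ᶠ ρ (charCoeff formRawRing S k)
  charCoeff-eval ρ A S h = coeff-∼ (formRelation ρ)
    (≡.subst₂ (Pointwise (RingRelation._∼_ (formRelation ρ)))
      (≡.sym (proj₂ (sealed rawRing A))) (≡.sym (proj₂ (sealed formRawRing S)))
      (charPoly-∼ (formRelation ρ) A S h))

-- Ordered fields

module OrderedField {c ℓ₁ ℓ₂} (ℝ : Reals c ℓ₁ ℓ₂) where
  open Reals ℝ
  open CommutativeRing commutativeRing public
    using (setoid; ring; sym; trans; +-cong; +-congˡ; +-congʳ; *-cong; *-congˡ; *-congʳ; -‿cong;
           +-identityˡ; +-identityʳ; *-identityʳ; *-identityˡ; zeroˡ; zeroʳ; -‿inverseʳ)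
    renaming (refl to ≈-refl)
  open IsDecTotalOrder isDecTotalOrder public using (antisym; total; _≟_; _≤?_; ≤-respʳ-≈; ≤-respˡ-≈)
    renaming (trans to ≤-trans; reflexive to ≤-reflexive; refl to ≤-refl)
  open RingProperties ring public using (x∙y⁻¹≈ε⇒x≈y)
  open Evaluation commutativeRing public
  open import Relation.Binary.Reasoning.Setoid setoid

  infixr 5 _▷_
  _▷_ : Carrier → (ℕ → Carrier) → ℕ → Carrier
  (x ▷ ρ) zero    = x
  (x ▷ ρ) (suc n) = ρ n

  ∅ : ℕ → Carrier
  ∅ _ = 0#

  ≤⇒0≤- : ∀ {x y} → x ≤ y → 0# ≤ y - x
  ≤⇒0≤- {x} {y} x≤y =
    ≤-respˡ-≈ (solve (x ▷ y ▷ ∅) ((:- v₀) :+ v₀) :0 refl)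
      (≤-respʳ-≈ (solve (x ▷ y ▷ ∅) ((:- v₀) :+ v₁) (v₁ ⊟ v₀) refl) (+-monoʳ-≤ (- x) x≤y))

  0≤-⇒≤ : ∀ {x y} → 0# ≤ y - x → x ≤ y
  0≤-⇒≤ {x} {y} 0≤y-x =
    ≤-respˡ-≈ (+-identityʳ x)
      (≤-respʳ-≈ (solve (x ▷ y ▷ ∅) (v₀ :+ (v₁ ⊟ v₀)) v₁ refl) (+-monoʳ-≤ x 0≤y-x))

  +-nonNeg : ∀ {x y} → 0# ≤ x → 0# ≤ y → 0# ≤ x + y
  +-nonNeg {x} 0≤x 0≤y = ≤-trans 0≤x (≤-respˡ-≈ (+-identityʳ x) (+-monoʳ-≤ x 0≤y))

  -0≈0 : - 0# ≈ 0#
  -0≈0 = solve ∅ (:- :0) :0 refl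

  ≰⇒0≤- : ∀ {x y} → ¬ (x ≤ y) → 0# ≤ x - y
  ≰⇒0≤- {x} {y} x≰y with total x y
  ... | inj₁ x≤y = contradiction x≤y x≰y
  ... | inj₂ y≤x = ≤⇒0≤- y≤x

  ≰0⇒0≤ : ∀ {x} → ¬ (0# ≤ x) → 0# ≤ - x
  ≰0⇒0≤ {x} 0≰x = ≤-respʳ-≈ (+-identityˡ (- x)) (≰⇒0≤- 0≰x)

  square-nonNeg : ∀ x → 0# ≤ x * x
  square-nonNeg x with 0# ≤? x
  ... | yes 0≤x = *-nonNeg 0≤x 0≤x
  ... | no  0≰x = ≤-respʳ-≈ (solve (x ▷ ∅) ((:- v₀) :* (:- v₀)) (v₀ :* v₀) refl)
                    (*-nonNeg (≰0⇒0≤ 0≰x) (≰0⇒0≤ 0≰x))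

  0≤1 : 0# ≤ 1#
  0≤1 = ≤-respʳ-≈ (*-identityʳ 1#) (square-nonNeg 1#)

  nonNeg∧nonPos⇒≈0 : ∀ {x} → 0# ≤ x → 0# ≤ - x → x ≈ 0#
  nonNeg∧nonPos⇒≈0 {x} 0≤x 0≤-x = antisym (0≤-⇒≤ (≤-respʳ-≈ (sym (+-identityˡ (- x))) 0≤-x)) 0≤x

  summandˡ≈0 : ∀ {x y} → 0# ≤ x → 0# ≤ y → 0# ≤ - (x + y) → x ≈ 0#
  summandˡ≈0 {x} {y} 0≤x 0≤y 0≤- = nonNeg∧nonPos⇒≈0 0≤x
    (≤-respʳ-≈ (solve (x ▷ y ▷ ∅) ((:- (v₀ :+ v₁)) :+ v₁) (:- v₀) refl) (+-nonNeg 0≤- 0≤y))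

  *-cancelˡ-≈0 : ∀ {x y} → ¬ (x ≈ 0#) → x * y ≈ 0# → y ≈ 0#
  *-cancelˡ-≈0 {x} {y} x≉0 xy≈0 = begin
    y                  ≈⟨ *-identityˡ y ⟨
    1# * y             ≈⟨ *-congʳ (*-inverseʳ x x≉0) ⟨
    x * x ⁻¹ * y       ≈⟨ solve (x ▷ x ⁻¹ ▷ y ▷ ∅) ((v₀ :* v₁) :* v₂) (v₁ :* (v₀ :* v₂)) refl ⟩
    x ⁻¹ * (x * y)     ≈⟨ *-congˡ xy≈0 ⟩
    x ⁻¹ * 0#          ≈⟨ zeroʳ _ ⟩
    0#                 ∎

  *-≉0 : ∀ {x y} → ¬ (x ≈ 0#) → ¬ (y ≈ 0#) → ¬ (x * y ≈ 0#)
  *-≉0 x≉0 y≉0 xy≈0 = y≉0 (*-cancelˡ-≈0 x≉0 xy≈0)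

  square≈0 : ∀ {x} → x * x ≈ 0# → x ≈ 0#
  square≈0 {x} xx≈0 with x ≟ 0#
  ... | yes x≈0 = x≈0
  ... | no  x≉0 = *-cancelˡ-≈0 x≉0 xx≈0

  *-cancelˡ-nonNeg : ∀ {x y} → 0# ≤ x → ¬ (x ≈ 0#) → 0# ≤ x * y → 0# ≤ y
  *-cancelˡ-nonNeg {x} {y} 0≤x x≉0 0≤xy with 0# ≤? y
  ... | yes 0≤y = 0≤y
  ... | no  0≰y = ≤-reflexive (sym (*-cancelˡ-≈0 x≉0 (nonNeg∧nonPos⇒≈0 0≤xy
    (≤-respʳ-≈ (solve (x ▷ y ▷ ∅) (v₀ :* (:- v₁)) (:- (v₀ :* v₁)) refl) (*-nonNeg 0≤x (≰0⇒0≤ 0≰y))))))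

  1≉0 : ¬ (1# ≈ 0#)
  1≉0 1≈0 = 0≉1 (sym 1≈0)

  nonNeg+1≉0 : ∀ {x} → 0# ≤ x → ¬ (1# + x ≈ 0#)
  nonNeg+1≉0 {x} 0≤x 1+x≈0 = 1≉0 (summandˡ≈0 0≤1 0≤x
    (≤-reflexive (trans (sym -0≈0) (-‿cong (sym 1+x≈0)))))

  2≉0 : ¬ (2# ≈ 0#)
  2≉0 = nonNeg+1≉0 0≤1

  ½ : Carrier
  ½ = 2# ⁻¹

  ½+½≈1 : ½ + ½ ≈ 1#
  ½+½≈1 = trans (solve (½ ▷ ∅) (v₀ :+ v₀) ((:1 :+ :1) :* v₀) refl) (*-inverseʳ 2# 2≉0)

  halves : ∀ x → x * ½ + x * ½ ≈ x
  halves x = begin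
    x * ½ + x * ½    ≈⟨ solve (x ▷ ½ ▷ ∅) ((v₀ :* v₁) :+ (v₀ :* v₁)) (v₀ :* (v₁ :+ v₁)) refl ⟩
    x * (½ + ½)      ≈⟨ *-congˡ ½+½≈1 ⟩
    x * 1#           ≈⟨ *-identityʳ x ⟩
    x                ∎

  0≤½ : 0# ≤ ½
  0≤½ = *-cancelˡ-nonNeg (+-nonNeg 0≤1 0≤1) 2≉0
    (≤-respʳ-≈ (sym (*-inverseʳ 2# 2≉0)) 0≤1)

  double≉0 : ∀ {x} → ¬ (x ≈ 0#) → ¬ (x + x ≈ 0#)
  double≉0 {x} x≉0 2x≈0 =
    *-≉0 2≉0 x≉0 (trans (solve (x ▷ ∅) ((:1 :+ :1) :* v₀) (v₀ :+ v₀) refl) 2x≈0)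

  module _ (ρ : ℕ → Carrier) (0≤ρ : ∀ x → 0# ≤ ρ x) where

    monomial-nonNeg : ∀ m → 0# ≤ ⟦_⟧ₘ ρ m
    monomial-nonNeg []      = 0≤1
    monomial-nonNeg (x ∷ m) = *-nonNeg (0≤ρ x) (monomial-nonNeg m)

    form-nonNeg : ∀ p → T (positive p) → 0# ≤ ⟦_⟧ᶠ ρ p
    form-nonNeg []               _ = ≤-refl
    form-nonNeg ((true , m) ∷ p) h = +-nonNeg (monomial-nonNeg m) (form-nonNeg p h)

    -- If no minus sign survives the expansion, every summand is a product of nonnegative numbers.
    positive⇒nonNeg : ∀ e → T (positive (normalise e)) → 0# ≤ ⟦_⟧ ρ e
    positive⇒nonNeg e h = ≤-respʳ-≈ (normalise-sound ρ e) (form-nonNeg (normalise e) h)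

  open RawSemiringDefinitions (RawRing.rawSemiring rawRing) using (sum)

  sum-nonNeg : ∀ {n} {f : Fin n → Carrier} → (∀ i → 0# ≤ f i) → 0# ≤ sum f
  sum-nonNeg {zero}  _ = ≤-refl
  sum-nonNeg {suc n} h = +-nonNeg (h zero) (sum-nonNeg λ i → h (suc i))

  sum≈0⇒≈0 : ∀ {n} (f : Fin n → Carrier) → (∀ i → 0# ≤ f i) → 0# ≤ - sum f → ∀ i → f i ≈ 0#
  sum≈0⇒≈0 f 0≤f h zero    = summandˡ≈0 (0≤f zero) (sum-nonNeg λ i → 0≤f (suc i)) h
  sum≈0⇒≈0 f 0≤f h (suc i) = sum≈0⇒≈0 (λ i → f (suc i)) (λ i → 0≤f (suc i))
    (≤-respʳ-≈ (solve (f zero ▷ sum (λ i → f (suc i)) ▷ ∅) ((:- (v₀ :+ v₁)) :+ v₀) (:- v₁) refl)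
      (+-nonNeg h (0≤f zero))) i

  ≈0⇒sum≈0 : ∀ {n} {f : Fin n → Carrier} → (∀ i → f i ≈ 0#) → sum f ≈ 0#
  ≈0⇒sum≈0 {zero}  _ = ≈-refl
  ≈0⇒sum≈0 {suc n} h = trans (+-cong (h zero) (≈0⇒sum≈0 λ i → h (suc i))) (+-identityʳ 0#)

  term≤sum : ∀ {n} {f : Fin n → Carrier} → (∀ i → 0# ≤ f i) → ∀ i → f i ≤ sum f
  term≤sum {f = f} 0≤f zero    = 0≤-⇒≤ (≤-respʳ-≈
    (solve (f zero ▷ sum (λ i → f (suc i)) ▷ ∅) v₁ ((v₀ :+ v₁) ⊟ v₀) refl)
    (sum-nonNeg λ i → 0≤f (suc i)))
  term≤sum {f = f} 0≤f (suc i) = ≤-trans (term≤sum (λ i → 0≤f (suc i)) i) (0≤-⇒≤ (≤-respʳ-≈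
    (solve (f zero ▷ sum (λ i → f (suc i)) ▷ ∅) v₀ ((v₀ :+ v₁) ⊟ v₁) refl) (0≤f zero)))

  sum-distance : ∀ {n} x (f g : Fin n → Carrier) →
                 sum (λ i → (x - f i) * g i) ≈ x * sum g - sum (λ i → f i * g i)
  sum-distance {zero}  x f g = solve (x ▷ ∅) :0 ((v₀ :* :0) :+ (:- :0)) refl
  sum-distance {suc n} x f g = trans (+-congˡ (sum-distance x (λ i → f (suc i)) (λ i → g (suc i))))
    (solve (x ▷ f zero ▷ g zero ▷ sum (λ i → g (suc i)) ▷ sum (λ i → f (suc i) * g (suc i)) ▷ ∅)
      (((v₀ ⊟ v₁) :* v₂) :+ ((v₀ :* :var 3) ⊟ :var 4))
      ((v₀ :* (v₂ :+ :var 3)) :+ (:- ((v₁ :* v₂) :+ :var 4))) refl)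

-- Weights on the edges of K₅

-- The edges of K₅ as vertices of the Petersen graph, adjacent when disjoint:
-- 0 is the edge 01; 1, 2, 3 join 0 and 4, 5, 6 join 1 to 2, 3, 4;
-- 7, 8, 9 are the edges 34, 24, 23.
module Petersen {c ℓ} (R : RawRing c ℓ) (w : Fin 10 → RawRing.Carrier R) where
  open RawRing R
  open RawSemiringDefinitions rawSemiring using (sum)

  infixl 6 _-_
  _-_ : Carrier → Carrier → Carrier
  x - y = x + - y

  p s₀ s₁ t matching slack parallel : Carrier
  p        = sum w
  s₀       = w 1F + w 2F + w 3F
  s₁       = w 4F + w 5F + w 6F
  t        = w 7F + w 8F + w 9F
  matching = w 0F * t + ((w 1F + w 4F) * w 7F + (w 2F + w 5F) * w 8F + (w 3F + w 6F) * w 9F)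
           + (w 1F * (w 5F + w 6F) + w 2F * (w 4F + w 6F) + w 3F * (w 4F + w 5F))
  slack    = (w 1F + w 4F) * (t - w 7F) + (w 2F + w 5F) * (t - w 8F) + (w 3F + w 6F) * (t - w 9F)
  parallel = w 1F * w 4F + w 2F * w 5F + w 3F * w 6F

  neighbours : Fin 10 → Carrier
  neighbours 0F = t
  neighbours 1F = w 7F + w 5F + w 6F
  neighbours 2F = w 8F + w 4F + w 6F
  neighbours 3F = w 9F + w 4F + w 5F
  neighbours 4F = w 7F + w 2F + w 3F
  neighbours 5F = w 8F + w 1F + w 3F
  neighbours 6F = w 9F + w 1F + w 2F
  neighbours 7F = w 0F + w 1F + w 4F
  neighbours 8F = w 0F + w 2F + w 5F
  neighbours 9F = w 0F + w 3F + w 6F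

  deviation : Carrier → Carrier
  deviation a = sum λ k → w k * ((neighbours k - a) * (neighbours k - a))

  defect : Carrier
  defect = p * matching - sum λ k → w k * (neighbours k * neighbours k)

  -- Both are the same polynomial; if p/2 ≤ a ≤ w 0F then every term of the
  -- second is nonnegative.
  excess gap : Carrier → Carrier
  excess a = a * (p - a) - matching - (w 0F - a) * (w 0F - a) - s₀ * s₀ - s₁ * s₁
  gap a = (w 0F + (s₀ + s₁) - a) * (a + a - p) + (1# + 1#) * (w 0F - a) * (s₀ + s₁)
        + s₀ * s₁ + slack + parallel

  deviation+defect : Carrier → Carrier
  deviation+defect a = p * matching - (a + a + a + a) * matching + a * a * p

module PetersenBounds {c ℓ₁ ℓ₂} (ℝ : Reals c ℓ₁ ℓ₂) (w : Fin 10 → Reals.Carrier ℝ)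
    (0≤w : ∀ k → Reals._≤_ ℝ (Reals.0# ℝ) (w k)) where
  open Reals ℝ
  open OrderedField ℝ
  open Petersen rawRing w hiding (_-_)
  open import Relation.Binary.Reasoning.Setoid setoid
  open RawSemiringDefinitions (RawRing.rawSemiring rawRing) using (sum)
  private
    -- `:P` shifts the weights by one so that variable 0 can stand for `a`; `:Q` serves for
    -- polynomials in the weights alone.
    module :P = Petersen exprRawRing (λ k → :var (suc (toℕ k)))
    module :Q = Petersen exprRawRing (λ k → :var (toℕ k))
    ρ : ℕ → Carrier
    ρ n = w (n mod 10)
    0≤ρ : ∀ n → 0# ≤ ρ n
    0≤ρ n = 0≤w (n mod 10)

  0≤p : 0# ≤ p
  0≤p = positive⇒nonNeg ρ 0≤ρ :Q.p _

  -- Stronger than D ≤ a (p - a) by three squares: equality there forces w₀ = a and kills every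
  -- 2-cycle with exactly one end in the edge 01.
  heavy-edge-bound : ∀ a → 0# ≤ w 0F - a → 0# ≤ a + a - p → 0# ≤ excess a
  heavy-edge-bound a a≤w₀ p≤2a =
    ≤-respʳ-≈ (solve (a ▷ ρ) (:P.gap (:var 0)) (:P.excess (:var 0)) refl)
      (+-nonNeg (+-nonNeg (+-nonNeg (+-nonNeg
        (*-nonNeg (≤-respʳ-≈ (solve (a ▷ ρ) ((:var 1 ⊟ :var 0) :+ (:P.s₀ :+ :P.s₁))
                                            ((:var 1 :+ (:P.s₀ :+ :P.s₁)) ⊟ :var 0) refl)
                     (+-nonNeg a≤w₀ (positive⇒nonNeg ρ 0≤ρ (:Q.s₀ :+ :Q.s₁) _)))
                  p≤2a)
        (*-nonNeg (*-nonNeg (+-nonNeg 0≤1 0≤1) a≤w₀) (positive⇒nonNeg ρ 0≤ρ (:Q.s₀ :+ :Q.s₁) _)))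
        (positive⇒nonNeg ρ 0≤ρ (:Q.s₀ :* :Q.s₁) _))
        (positive⇒nonNeg ρ 0≤ρ :Q.slack _))
        (positive⇒nonNeg ρ 0≤ρ :Q.parallel _))

  -- The Petersen graph has no triangles, so adjacent k and l satisfy
  -- neighbours k + neighbours l ≤ p.
  0≤defect : 0# ≤ defect
  0≤defect = positive⇒nonNeg ρ 0≤ρ :Q.defect _

  -- Write N for `neighbours`. The defect is the sum of w k w l (p - N k - N l) over adjacent pairs,
  -- and the three pairs containing vertex 0 contribute exactly `w 0F * slack`.
  slack≤defect : 0# ≤ defect - w 0F * slack
  slack≤defect = positive⇒nonNeg ρ 0≤ρ (:Q.defect ⊟ (:var 0 :* :Q.slack)) _

  module _ (a : Carrier) (p≈2a : p ≈ a + a) where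

    -- Σ w (N − a)² + (p D − Σ w N²) = 2a (a² − D), since Σ w N = 2 D.
    balance : deviation a + defect ≈ (a + a) * (a * a - matching)
    balance = begin
      deviation a + defect
        ≈⟨ solve (a ▷ ρ) (:P.deviation (:var 0) :+ :P.defect) (:P.deviation+defect (:var 0)) refl ⟩
      p * matching - (a + a + a + a) * matching + a * a * p
        ≈⟨ +-cong (+-congʳ (*-congʳ p≈2a)) (*-congˡ p≈2a) ⟩
      (a + a) * matching - (a + a + a + a) * matching + a * a * (a + a)
        ≈⟨ solve (a ▷ matching ▷ ∅)
             ((((v₀ :+ v₀) :* v₁) :+ (:- ((((v₀ :+ v₀) :+ v₀) :+ v₀) :* v₁))) :+ ((v₀ :* v₀) :* (v₀ :+ v₀)))
             ((v₀ :+ v₀) :* ((v₀ :* v₀) ⊟ v₁)) refl ⟩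
      (a + a) * (a * a - matching) ∎

    0≤deviation-term : ∀ k → 0# ≤ w k * ((neighbours k - a) * (neighbours k - a))
    0≤deviation-term k = *-nonNeg (0≤w k) (square-nonNeg _)

    -- Both remainders in `balance` are nonnegative, and 2a can be cancelled. Here a² is p²/4, the
    -- bound for clique number two.
    motzkin-straus : 0# ≤ a → ¬ (a ≈ 0#) → 0# ≤ a * a - matching
    motzkin-straus 0≤a a≉0 = *-cancelˡ-nonNeg (+-nonNeg 0≤a 0≤a) (double≉0 a≉0)
      (≤-respʳ-≈ balance (+-nonNeg (sum-nonNeg 0≤deviation-term) 0≤defect))

    -- At equality the vertices of positive weight span a complete bipartite graph with both sides
    -- of weight `a`. The Petersen graph has girth five, so this is a star, and its centre has
    -- weight `a`. The argument below is an algebraic version, read off at the heaviest vertex.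
    motzkin-straus-equality : 0# ≤ a → ¬ (a ≈ 0#) → 0# ≤ matching - a * a →
                              (∀ k → 0# ≤ w 0F - w k) → 0# ≤ w 0F - a
    motzkin-straus-equality 0≤a a≉0 a²≤D w≤w₀ with 0# ≤? (w 0F - a)
    ... | yes a≤w₀ = a≤w₀
    ... | no  a≰w₀ = ≤-reflexive (begin
      0#              ≈⟨ -0≈0 ⟨
      - 0#            ≈⟨ -‿cong d≈0 ⟨
      - (a - w 0F)    ≈⟨ solve (a ▷ w 0F ▷ ∅) (:- (v₀ ⊟ v₁)) (v₁ ⊟ v₀) refl ⟩
      w 0F - a        ∎)
      where
      s : Carrier
      s = s₀ + s₁

      vanishing : 0# ≤ - (deviation a + defect)
      vanishing = ≤-respʳ-≈ (begin
        (a + a) * (matching - a * a)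
          ≈⟨ solve (a ▷ matching ▷ ∅) ((v₀ :+ v₀) :* (v₁ :+ (:- (v₀ :* v₀))))
               (:- ((v₀ :+ v₀) :* ((v₀ :* v₀) ⊟ v₁))) refl ⟩
        - ((a + a) * (a * a - matching))   ≈⟨ -‿cong balance ⟨
        - (deviation a + defect)           ∎)
        (*-nonNeg (+-nonNeg 0≤a 0≤a) a²≤D)

      0≤deviation : 0# ≤ deviation a
      0≤deviation = sum-nonNeg 0≤deviation-term

      deviation≈0 : deviation a ≈ 0#
      deviation≈0 = summandˡ≈0 0≤deviation 0≤defect vanishing

      defect≈0 : defect ≈ 0#
      defect≈0 = summandˡ≈0 0≤defect 0≤deviation
        (≤-respʳ-≈ (solve (deviation a ▷ defect ▷ ∅) (:- (v₀ :+ v₁)) (:- (v₁ :+ v₀)) refl) vanishing)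

      w₀≉0 : ¬ (w 0F ≈ 0#)
      w₀≉0 w₀≈0 = double≉0 a≉0 (trans (sym p≈2a) (nonNeg∧nonPos⇒≈0 0≤p (≤-respʳ-≈ (begin
        sum (λ k → w 0F - w k)
          ≈⟨ solve ρ (RawSemiringDefinitions.sum (RawRing.rawSemiring exprRawRing)
                       (λ (k : Fin 10) → :var 0 ⊟ :var (toℕ k)))
                     ((ten :* :var 0) :+ (:- :Q.p)) refl ⟩
        ⟦_⟧ ρ ten * w 0F + - p
          ≈⟨ +-congʳ (trans (*-congˡ w₀≈0) (zeroʳ _)) ⟩
        0# + - p
          ≈⟨ +-identityˡ _ ⟩
        - p ∎) (sum-nonNeg w≤w₀))))
        where
        ten : Expr
        ten = RawSemiringDefinitions.sum (RawRing.rawSemiring exprRawRing) (λ (_ : Fin 10) → :1)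

      -- Vertex 0 has nonzero weight, so its term of the deviation vanishes only if its
      -- neighbourhood, of weight `t`, weighs `a`.
      t-a≈0 : t - a ≈ 0#
      t-a≈0 = square≈0 (*-cancelˡ-≈0 w₀≉0 (summandˡ≈0 (0≤deviation-term 0F)
        (sum-nonNeg λ k → 0≤deviation-term (suc k))
        (≤-reflexive (trans (sym -0≈0) (-‿cong (sym deviation≈0))))))

      slack≈0 : slack ≈ 0#
      slack≈0 = *-cancelˡ-≈0 w₀≉0 (nonNeg∧nonPos⇒≈0
        (*-nonNeg (0≤w 0F) (positive⇒nonNeg ρ 0≤ρ :Q.slack _))
        (≤-respʳ-≈ (trans (+-congʳ defect≈0) (+-identityˡ _)) slack≤defect))

      s≈a-w₀ : s ≈ a - w 0F
      s≈a-w₀ = begin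
        s                                 ≈⟨ solve (a ▷ ρ) (:P.s₀ :+ :P.s₁)
                                               (((:P.p ⊟ :var 1) ⊟ (:P.t ⊟ :var 0)) ⊟ :var 0) refl ⟩
        p - w 0F - (t - a) - a            ≈⟨ +-congʳ (+-cong (+-congʳ p≈2a) (-‿cong t-a≈0)) ⟩
        a + a - w 0F - 0# - a             ≈⟨ solve (a ▷ w 0F ▷ ∅) (((((v₀ :+ v₀) ⊟ v₁) :+ (:- :0)) ⊟ v₀))
                                               (v₀ ⊟ v₁) refl ⟩
        a - w 0F                          ∎

      t-w₀≈a-w₀ : t - w 0F ≈ a - w 0F
      t-w₀≈a-w₀ = begin
        t - w 0F                ≈⟨ solve (a ▷ ρ) (:P.t ⊟ :var 1) ((:P.t ⊟ :var 0) :+ (:var 0 ⊟ :var 1)) refl ⟩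
        (t - a) + (a - w 0F)    ≈⟨ +-congʳ t-a≈0 ⟩
        0# + (a - w 0F)         ≈⟨ +-identityˡ _ ⟩
        a - w 0F                ∎

      -- Replacing `t` by `w 0F` in `slack` lowers it by `s * (t - w 0F)`, which is the square of
      -- `a - w 0F`. The result is nonnegative by maximality of `w 0F`, while `slack` itself is
      -- zero.
      d≈0 : a - w 0F ≈ 0#
      d≈0 = square≈0 (nonNeg∧nonPos⇒≈0 (square-nonNeg _) (≤-respʳ-≈ (begin
        (w 1F + w 4F) * (w 0F - w 7F) + (w 2F + w 5F) * (w 0F - w 8F) + (w 3F + w 6F) * (w 0F - w 9F)
          ≈⟨ solve ρ (((:var 1 :+ :var 4) :* (:var 0 ⊟ :var 7) :+ (:var 2 :+ :var 5) :* (:var 0 ⊟ :var 8))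
                       :+ (:var 3 :+ :var 6) :* (:var 0 ⊟ :var 9))
                     (:Q.slack ⊟ ((:Q.s₀ :+ :Q.s₁) :* (:Q.t ⊟ :var 0))) refl ⟩
        slack - s * (t - w 0F)
          ≈⟨ +-cong slack≈0 (-‿cong (*-cong s≈a-w₀ t-w₀≈a-w₀)) ⟩
        0# - (a - w 0F) * (a - w 0F)
          ≈⟨ +-identityˡ _ ⟩
        - ((a - w 0F) * (a - w 0F)) ∎)
        (+-nonNeg (+-nonNeg (*-nonNeg (+-nonNeg (0≤w 1F) (0≤w 4F)) (w≤w₀ 7F))
                            (*-nonNeg (+-nonNeg (0≤w 2F) (0≤w 5F)) (w≤w₀ 8F)))
                            (*-nonNeg (+-nonNeg (0≤w 3F) (0≤w 6F)) (w≤w₀ 9F)))))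

-- Cycles of a 5 × 5 matrix

ends : Fin 10 → Fin 5 × Fin 5
ends 0F = 0F , 1F
ends 1F = 0F , 2F
ends 2F = 0F , 3F
ends 3F = 0F , 4F
ends 4F = 1F , 2F
ends 5F = 1F , 3F
ends 6F = 1F , 4F
ends 7F = 3F , 4F
ends 8F = 2F , 4F
ends 9F = 2F , 3F

complement : Fin 10 → Fin 5 × Fin 5 × Fin 5
complement 0F = 2F , 3F , 4F
complement 1F = 1F , 3F , 4F
complement 2F = 1F , 2F , 4F
complement 3F = 1F , 2F , 3F
complement 4F = 0F , 3F , 4F
complement 5F = 0F , 2F , 4F
complement 6F = 0F , 2F , 3F
complement 7F = 0F , 1F , 2F
complement 8F = 0F , 1F , 3F
complement 9F = 0F , 1F , 4F

module Cycles {c ℓ} (R : RawRing c ℓ) (A : SquareMatrices.Matrix R 5) where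
  open RawRing R
  open RawSemiringDefinitions rawSemiring using (sum)

  path : Fin 5 → Fin 5 → List (Fin 5) → Carrier
  path i j []       = A i j
  path i j (k ∷ ks) = A i k * path k j ks

  cycle : List (Fin 5) → Carrier
  cycle []       = 1#
  cycle (i ∷ is) = path i i is

  -- The 3-cycles are indexed by the complementary edge, both orientations together, so that E
  -- becomes the scalar product of `weight` and `triangle`.
  weight triangle : Fin 10 → Carrier
  weight   k = let (i , j) = ends k in cycle (i ∷ j ∷ [])
  triangle k = let (x , y , z) = complement k in cycle (x ∷ y ∷ z ∷ []) + cycle (x ∷ z ∷ y ∷ [])

  open Petersen R weight public

  triangles edge-triangles : Carrier
  triangles      = sum triangle
  edge-triangles = sum λ k → weight k * triangle k

encode : Fin 5 → Fin 5 → ℕ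
encode i j = toℕ i ℕ.* 5 ℕ.+ toℕ j

decode : ℕ → Fin 5 × Fin 5
decode n = (n ÷ 5) mod 5 , n mod 5

decode-encode : ∀ i j → decode (encode i j) ≡ (i , j)
decode-encode = from-yes (Fin.all? λ i → Fin.all? λ j → ≡-dec Fin._≟_ Fin._≟_ (decode (encode i j)) (i , j))

generic hollow : SquareMatrices.Matrix formRawRing 5
generic i j = var (encode i j)
hollow i j with i Fin.≟ j
... | yes _ = []
... | no  _ = generic i j

:entry : SquareMatrices.Matrix exprRawRing 5
:entry i j = :var (encode i j)

module :C = Cycles exprRawRing :entry

-- Relabelling the vertices

label : (i j : Fin 5) → Permutation′ 5
label i j = transpose 1F (transpose 0F i ⟨$⟩ʳ j) ∘ₚ transpose 0F i

label-0-1 : ∀ i j → i ≢ j → (label i j ⟨$⟩ʳ 0F) ≡ i × (label i j ⟨$⟩ʳ 1F) ≡ j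
label-0-1 = from-yes (Fin.all? λ i → Fin.all? λ j → ¬? (i Fin.≟ j) →-dec
  (((label i j ⟨$⟩ʳ 0F) Fin.≟ i) ×-dec ((label i j ⟨$⟩ʳ 1F) Fin.≟ j)))

renameMonomial : (ℕ → ℕ) → Monomial → Monomial
renameMonomial f []      = []
renameMonomial f (x ∷ m) = insertVar (f x) (renameMonomial f m)

rename : (ℕ → ℕ) → Form → Form
rename f []            = []
rename f ((s , m) ∷ p) = ((s , renameMonomial f m) ∷ []) ⊕ rename f p

invariant : (ℕ → ℕ) → Form → Bool
invariant f p = null (rename f p ⊕ (⊖ p))

module _ {c ℓ} (R : CommutativeRing c ℓ) where
  open CommutativeRing R renaming (refl to ≈-refl)
  open Evaluation R
  open import Algebra.Properties.Ring ring using (x∙y⁻¹≈ε⇒x≈y)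
  open import Relation.Binary.Reasoning.Setoid setoid

  module _ (ρ : ℕ → Carrier) (f : ℕ → ℕ) where

    renameMonomial-sound : ∀ m → ⟦_⟧ₘ ρ (renameMonomial f m) ≈ ⟦_⟧ₘ (λ n → ρ (f n)) m
    renameMonomial-sound []      = ≈-refl
    renameMonomial-sound (x ∷ m) =
      trans (insertVar-sound ρ (f x) (renameMonomial f m)) (*-congˡ (renameMonomial-sound m))

    rename-sound : ∀ p → ⟦_⟧ᶠ ρ (rename f p) ≈ ⟦_⟧ᶠ (λ n → ρ (f n)) p
    rename-sound []            = ≈-refl
    rename-sound ((s , m) ∷ p) = trans (⊕-sound ρ ((s , renameMonomial f m) ∷ []) (rename f p))
      (+-cong (trans (+-identityʳ _) (signed-cong s (renameMonomial-sound m))) (rename-sound p))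

    invariant-sound : ∀ p → T (invariant f p) → ⟦_⟧ᶠ (λ n → ρ (f n)) p ≈ ⟦_⟧ᶠ ρ p
    invariant-sound p h = begin
      ⟦_⟧ᶠ (λ n → ρ (f n)) p   ≈⟨ rename-sound p ⟨
      ⟦_⟧ᶠ ρ (rename f p)      ≈⟨ x∙y⁻¹≈ε⇒x≈y _ _ (begin
        ⟦_⟧ᶠ ρ (rename f p) - ⟦_⟧ᶠ ρ p          ≈⟨ +-congˡ (⊖-sound ρ p) ⟨
        ⟦_⟧ᶠ ρ (rename f p) + ⟦_⟧ᶠ ρ (⊖ p)      ≈⟨ ⊕-sound ρ (rename f p) (⊖ p) ⟨
        ⟦_⟧ᶠ ρ (rename f p ⊕ (⊖ p))             ≈⟨ null-sound ρ _ h ⟩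
        0#                                      ∎) ⟩
      ⟦_⟧ᶠ ρ p                 ∎

relabelling : Permutation′ 5 → ℕ → ℕ
relabelling τ n = let (i , j) = decode n in encode (τ ⟨$⟩ʳ i) (τ ⟨$⟩ʳ j)

:trace : Expr
:trace = RawSemiringDefinitions.sum (RawRing.rawSemiring exprRawRing) (λ (i : Fin 5) → :entry i i)

-- Coefficients of the symbolic characteristic polynomials

opaque
  unfolding sealed

  generic-coeff₄ : T (null (charCoeff formRawRing generic 4 ⊕ (⊖ normalise (:- :trace))))
  generic-coeff₄ = tt

  hollow-coeff₃ : T (null (charCoeff formRawRing hollow 3 ⊕ (⊖ normalise (:- :C.p))))
  hollow-coeff₃ = tt

  hollow-coeff₂ : T (null (charCoeff formRawRing hollow 2 ⊕ (⊖ normalise (:- :C.triangles))))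
  hollow-coeff₂ = tt

  -- What remains is the total weight of the 4-cycles; for the constant coefficient it is that of
  -- the 5-cycles.
  hollow-coeff₁ : T (positive (normalise :C.matching ⊕ (⊖ charCoeff formRawRing hollow 1)))
  hollow-coeff₁ = tt

  hollow-coeff₀ : T (positive (normalise :C.edge-triangles ⊕ (⊖ charCoeff formRawRing hollow 0)))
  hollow-coeff₀ = tt

module NonNegativeMatrix {c ℓ₁ ℓ₂} (ℝ : Reals c ℓ₁ ℓ₂)
    (A : SquareMatrices.Matrix (Reals.rawRing ℝ) 5)
    (0≤A : Realizability.NonNegative ℝ A) where
  open Reals ℝ
  open OrderedField ℝ
  open CommutativeRing commutativeRing using (reflexive)
  open RawSemiringDefinitions (RawRing.rawSemiring rawRing) using (sum)

  ρ : ℕ → Carrier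
  ρ n = let (i , j) = decode n in A i j

  0≤ρ : ∀ n → 0# ≤ ρ n
  0≤ρ n = 0≤A _ _

  generic-eval : ∀ i j → ⟦_⟧ᶠ ρ (generic i j) ≈ A i j
  generic-eval i j = trans (var-sound ρ (encode i j))
    (reflexive (≡.cong (λ (k , l) → A k l) (decode-encode i j)))

  -- The coefficient is minus the trace, a sum of nonnegative entries.
  coeff₄≈0⇒diagonal≈0 : charCoeff rawRing A 4 ≈ 0# → ∀ i → A i i ≈ 0#
  coeff₄≈0⇒diagonal≈0 h = sum≈0⇒≈0 (λ i → A i i) (λ i → 0≤A i i) (≤-reflexive (begin
    0#                                        ≈⟨ h ⟨
    charCoeff rawRing A 4
      ≈⟨ Transfer.charCoeff-eval commutativeRing ρ A generic (λ i j → sym (generic-eval i j)) 4 ⟩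
    ⟦_⟧ᶠ ρ (charCoeff formRawRing generic 4)
      ≈⟨ form-identity ρ (charCoeff formRawRing generic 4) (:- :trace) generic-coeff₄ ⟩
    - sum (λ i → A i i)                       ∎))
    where open import Relation.Binary.Reasoning.Setoid setoid

module HollowMatrix {c ℓ₁ ℓ₂} (ℝ : Reals c ℓ₁ ℓ₂)
    (A : SquareMatrices.Matrix (Reals.rawRing ℝ) 5)
    (0≤A : Realizability.NonNegative ℝ A)
    (diagonal≈0 : ∀ i → Reals._≈_ ℝ (A i i) (Reals.0# ℝ)) where
  open Reals ℝ
  open OrderedField ℝ
  open Cycles rawRing A public hiding (_-_)
  open NonNegativeMatrix ℝ A 0≤A public

  hollow-eval : ∀ i j → A i j ≈ ⟦_⟧ᶠ ρ (hollow i j)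
  hollow-eval i j with i Fin.≟ j
  ... | yes refl = diagonal≈0 i
  ... | no  _    = sym (generic-eval i j)

  coeff-eval : ∀ n → charCoeff rawRing A n ≈ ⟦_⟧ᶠ ρ (charCoeff formRawRing hollow n)
  coeff-eval = Transfer.charCoeff-eval commutativeRing ρ A hollow hollow-eval

  weight-nonNeg : ∀ k → 0# ≤ weight k
  weight-nonNeg k = *-nonNeg (0≤A _ _) (0≤A _ _)

  triangle-nonNeg : ∀ k → 0# ≤ triangle k
  triangle-nonNeg k = +-nonNeg (*-nonNeg (0≤A _ _) (*-nonNeg (0≤A _ _) (0≤A _ _)))
                               (*-nonNeg (0≤A _ _) (*-nonNeg (0≤A _ _) (0≤A _ _)))

  form-bound : ∀ f e → T (positive (normalise e ⊕ (⊖ f))) → 0# ≤ ⟦_⟧ ρ e - ⟦_⟧ᶠ ρ f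
  form-bound f e h = positive⇒nonNeg ρ 0≤ρ (e :+ (:- :form f)) h

  coeff₃ : charCoeff rawRing A 3 ≈ - p
  coeff₃ = trans (coeff-eval 3) (form-identity ρ (charCoeff formRawRing hollow 3) (:- :C.p) hollow-coeff₃)

  coeff₂ : charCoeff rawRing A 2 ≈ - triangles
  coeff₂ = trans (coeff-eval 2) (form-identity ρ (charCoeff formRawRing hollow 2) (:- :C.triangles) hollow-coeff₂)

  coeff₁ : 0# ≤ matching - charCoeff rawRing A 1
  coeff₁ = ≤-respʳ-≈ (+-congˡ (-‿cong (sym (coeff-eval 1))))
    (form-bound (charCoeff formRawRing hollow 1) :C.matching hollow-coeff₁)

  coeff₀ : 0# ≤ edge-triangles - charCoeff rawRing A 0
  coeff₀ = ≤-respʳ-≈ (+-congˡ (-‿cong (sym (coeff-eval 0))))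
    (form-bound (charCoeff formRawRing hollow 0) :C.edge-triangles hollow-coeff₀)

-- Moving the heaviest 2-cycle to the vertices 0 and 1

every : ∀ {n} → (Fin n → Bool) → Bool
every {zero}  f = true
every {suc n} f = f zero ∧ every (λ i → f (suc i))

every-sound : ∀ {n} (f : Fin n → Bool) → T (every f) → ∀ i → T (f i)
every-sound f h zero    = proj₁ (Equivalence.to T-∧ h)
every-sound f h (suc i) = every-sound (λ i → f (suc i)) (proj₂ (Equivalence.to T-∧ h)) i

-- Each `label` is a product of two of these, so invariance has to be verified for ten permutations
-- only.
swap : Fin 2 → Fin 5 → Permutation′ 5
swap 0F = transpose 0F
swap 1F = transpose 1F

-- Relabelling a matrix renames the variables of its symbolic coefficients. Invariance of the
-- characteristic polynomial is therefore a computation on forms rather than a theorem on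
-- determinants.
swapsInvariant : List Form → Bool
swapsInvariant ps = every λ e → every λ i → all (invariant (relabelling (swap e i))) ps

swapsInvariant-sound : ∀ ps → T (swapsInvariant ps) → ∀ e i → T (all (invariant (relabelling (swap e i))) ps)
swapsInvariant-sound ps h e = every-sound _
  (every-sound (λ e → every λ i → all (invariant (relabelling (swap e i))) ps) h e)

opaque
  unfolding sealed

  hollow-swapsInvariant : T (swapsInvariant (proj₁ (sealed formRawRing hollow)))
  hollow-swapsInvariant = tt

relabel : ∀ {a} {C : Set a} → Permutation′ 5 → (Fin 5 → Fin 5 → C) → Fin 5 → Fin 5 → C
relabel τ A i j = A (τ ⟨$⟩ʳ i) (τ ⟨$⟩ʳ j)

module Normalisation {c ℓ₁ ℓ₂} (ℝ : Reals c ℓ₁ ℓ₂) where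
  open Reals ℝ
  open OrderedField ℝ
  open Realizability ℝ using (NonNegative; Irreducible)
  open SquareMatrices rawRing using (Matrix)

  Diagonal≈0 : Matrix 5 → Set ℓ₁
  Diagonal≈0 A = ∀ i → A i i ≈ 0#

  coeff-invariant : ∀ ρ f ps → T (all (invariant f) ps) → ∀ n →
    ⟦_⟧ᶠ (λ x → ρ (f x)) (Polynomials.coeff formRawRing ps n) ≈ ⟦_⟧ᶠ ρ (Polynomials.coeff formRawRing ps n)
  coeff-invariant ρ f []       h n       = ≈-refl
  coeff-invariant ρ f (p ∷ ps) h zero    = invariant-sound commutativeRing ρ f p (proj₁ (Equivalence.to T-∧ h))
  coeff-invariant ρ f (p ∷ ps) h (suc n) = coeff-invariant ρ f ps (proj₂ (Equivalence.to T-∧ h)) n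

  module _ (A : Matrix 5) (0≤A : NonNegative A) (diagonal≈0 : Diagonal≈0 A) where
    open HollowMatrix ℝ A 0≤A diagonal≈0

    charCoeff-swap : ∀ e i n → charCoeff rawRing (relabel (swap e i) A) n ≈ charCoeff rawRing A n
    charCoeff-swap e i n = begin
      charCoeff rawRing (relabel τ A) n
        ≈⟨ Transfer.charCoeff-eval commutativeRing ρ′ (relabel τ A) hollow relabel-eval n ⟩
      ⟦_⟧ᶠ ρ′ (charCoeff formRawRing hollow n)
        ≈⟨ coeff-invariant ρ (relabelling τ) (proj₁ (sealed formRawRing hollow))
             (swapsInvariant-sound (proj₁ (sealed formRawRing hollow)) hollow-swapsInvariant e i) n ⟩
      ⟦_⟧ᶠ ρ (charCoeff formRawRing hollow n)
        ≈⟨ coeff-eval n ⟨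
      charCoeff rawRing A n ∎
      where
      open import Relation.Binary.Reasoning.Setoid setoid
      open CommutativeRing commutativeRing using (reflexive)
      τ : Permutation′ 5
      τ = swap e i
      ρ′ : ℕ → Carrier
      ρ′ x = ρ (relabelling τ x)
      ρ′-encode : ∀ k l → ρ′ (encode k l) ≡ A (τ ⟨$⟩ʳ k) (τ ⟨$⟩ʳ l)
      ρ′-encode k l = ≡.trans
        (≡.cong (λ (i , j) → ρ (encode (τ ⟨$⟩ʳ i) (τ ⟨$⟩ʳ j))) (decode-encode k l))
        (≡.cong (λ (i , j) → A i j) (decode-encode (τ ⟨$⟩ʳ k) (τ ⟨$⟩ʳ l)))
      relabel-eval : ∀ k l → relabel τ A k l ≈ ⟦_⟧ᶠ ρ′ (hollow k l)
      relabel-eval k l with k Fin.≟ l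
      ... | yes refl = diagonal≈0 _
      ... | no  _    = trans (reflexive (≡.sym (ρ′-encode k l))) (sym (var-sound ρ′ (encode k l)))

  argmax : ∀ {n} (f : Fin (suc n) → Carrier) → ∃ λ i → ∀ j → f j ≤ f i
  argmax {zero}  f = 0F , λ { 0F → ≤-refl }
  argmax {suc n} f with argmax (λ i → f (suc i))
  ... | i , fj≤fi with total (f (suc i)) (f 0F)
  ...   | inj₁ fi≤f0 = 0F , λ { 0F → ≤-refl ; (suc j) → ≤-trans (fj≤fi j) fi≤f0 }
  ...   | inj₂ f0≤fi = suc i , λ { 0F → f0≤fi ; (suc j) → fj≤fi j }

  Maximal₀₁ : Matrix 5 → Set ℓ₂
  Maximal₀₁ A = ∀ k l → A k l * A l k ≤ A 0F 1F * A 1F 0F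

  module _ (A : Matrix 5) (0≤A : NonNegative A) (diagonal≈0 : Diagonal≈0 A) where

    private
      w : Fin 5 → Fin 5 → Carrier
      w k l = A k l * A l k

    Heaviest : Set ℓ₂
    Heaviest = ∃[ i ] ∃[ j ] i ≢ j × (∀ k l → w k l ≤ w i j)

    offDiagonal : ∀ i j → (∀ k l → w k l ≤ w i j) → Heaviest
    offDiagonal i j h with i Fin.≟ j
    ... | no  i≢j  = i , j , i≢j , h
    -- A maximum on the diagonal equals zero, and the weight of the pair 0, 1 is at least that.
    ... | yes refl = 0F , 1F , (λ ()) , λ k l → ≤-trans (h k l)
      (≤-respˡ-≈ (sym (trans (*-congˡ (diagonal≈0 i)) (zeroʳ _))) (*-nonNeg (0≤A _ _) (0≤A _ _)))

    heaviest : Heaviest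
    heaviest = offDiagonal _ _ λ k l → ≤-trans (proj₂ (row k) l) (proj₂ best k)
      where
      row : ∀ k → ∃ λ l → ∀ m → w k m ≤ w k l
      row k = argmax (w k)
      best : ∃ λ i → ∀ k → w k (proj₁ (row k)) ≤ w i (proj₁ (row i))
      best = argmax λ k → w k (proj₁ (row k))

    charCoeff-label : ∀ i j n → charCoeff rawRing (relabel (label i j) A) n ≈ charCoeff rawRing A n
    charCoeff-label i j n = trans
      (charCoeff-swap (relabel (swap 0F i) A) (λ _ _ → 0≤A _ _) (λ _ → diagonal≈0 _) 1F (transpose 0F i ⟨$⟩ʳ j) n)
      (charCoeff-swap A 0≤A diagonal≈0 0F i n)

    maximal-label : ∀ i j → i ≢ j → (∀ k l → w k l ≤ w i j) → Maximal₀₁ (relabel (label i j) A)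
    maximal-label i j i≢j h k l = ≡.subst₂ (λ u v → w (label i j ⟨$⟩ʳ k) (label i j ⟨$⟩ʳ l) ≤ w u v)
        (≡.sym (proj₁ (label-0-1 i j i≢j))) (≡.sym (proj₂ (label-0-1 i j i≢j)))
        (h (label i j ⟨$⟩ʳ k) (label i j ⟨$⟩ʳ l))

    normalisation : ∃[ τ ] (∀ n → charCoeff rawRing (relabel τ A) n ≈ charCoeff rawRing A n) × Maximal₀₁ (relabel τ A)
    normalisation = let (i , j , i≢j , h) = heaviest in
      label i j , charCoeff-label i j , maximal-label i j i≢j h

-- Reducibility

-- The simple cycles that start with the arc 0 → 4, up to exchanging 2 and 3.
crossingCycles : List (List (Fin 5))
crossingCycles =
  (0F ∷ 4F ∷ []) ∷ (0F ∷ 4F ∷ 1F ∷ []) ∷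
  (0F ∷ 4F ∷ 3F ∷ []) ∷ (0F ∷ 4F ∷ 3F ∷ 1F ∷ []) ∷
  (0F ∷ 4F ∷ 2F ∷ []) ∷ (0F ∷ 4F ∷ 2F ∷ 1F ∷ []) ∷
  (0F ∷ 4F ∷ 3F ∷ 2F ∷ []) ∷ (0F ∷ 4F ∷ 3F ∷ 2F ∷ 1F ∷ []) ∷ []

head : Fin 2 → Fin 5
head 0F = 0F
head 1F = 1F

tail : Fin 3 → Fin 5
tail 0F = 2F
tail 1F = 3F
tail 2F = 4F

-- Carries the arc 0 → 4 to `head i` → `tail x` and vertex 1 to the other head, so a single arc
-- needs to be studied.
arcLabel : Fin 2 → Fin 3 → Permutation′ 5
arcLabel i x = transpose (tail x) 4F ∘ₚ transpose 0F (head i)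

swap₂₃ : Fin 2 → Permutation′ 5
swap₂₃ 0F = Permutation.id
swap₂₃ 1F = transpose 2F 3F

fullLabel : Fin 2 → Fin 3 → Fin 2 → Permutation′ 5
fullLabel i x e = swap₂₃ e ∘ₚ arcLabel i x

-- The total weight of the cycles that meet both {0, 1} and {2, 3, 4}.
:crossing : Expr
:crossing = :C.s₀ :+ :C.s₁ :+ (:C.triangles ⊟ :C.triangle 0F)
         :+ (:C.matching ⊟ :form (charCoeff formRawRing hollow 1))
         :+ (:C.edge-triangles ⊟ :form (charCoeff formRawRing hollow 0))

module FC = Cycles formRawRing generic

dominates : Form → List (Fin 5) → Bool
dominates f is = positive (f ⊕ (⊖ FC.cycle is))

relabelled : Permutation′ 5 → List (Fin 5) → List (Fin 5)
relabelled τ = map (τ ⟨$⟩ʳ_)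

dominatesAll : Form → Bool
dominatesAll f = every λ i → every λ x → every λ e →
  all (λ is → dominates f (relabelled (fullLabel i x e) is)) crossingCycles

dominatesAll-sound : ∀ f → T (dominatesAll f) → ∀ i x e →
  T (all (λ is → dominates f (relabelled (fullLabel i x e) is)) crossingCycles)
dominatesAll-sound f h i x = every-sound _ (every-sound
  (λ x → every λ e → all (λ is → dominates f (relabelled (fullLabel i x e) is)) crossingCycles)
  (every-sound (λ i → every λ x → every λ e →
    all (λ is → dominates f (relabelled (fullLabel i x e) is)) crossingCycles) h i) x)

opaque
  unfolding sealed

  crossing-dominatesAll : T (dominatesAll (normalise :crossing))
  crossing-dominatesAll = tt

module Connectivity {c ℓ₁ ℓ₂} (ℝ : Reals c ℓ₁ ℓ₂) where
  open Reals ℝ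
  open OrderedField ℝ
  open Realizability ℝ using (NonNegative; Irreducible)
  open SquareMatrices rawRing using (Matrix)
  open CommutativeRing commutativeRing using (reflexive)

  irreducible-relabel : ∀ {A : Matrix 5} τ → Irreducible A → Irreducible (relabel τ A)
  irreducible-relabel τ irr (π , m , 0<m , m<5 , block) = irr (π ∘ₚ τ , m , 0<m , m<5 , block)

  module Escape (C : Matrix 5) (irr : Irreducible C) where

    -- A final segment of the vertices that no arc leaves is a vanishing lower left block for the
    -- identity permutation; likewise for the two larger segments below.
    from-4 : C 4F 0F ≈ 0# → C 4F 1F ≈ 0# → C 4F 2F ≈ 0# → C 4F 3F ≈ 0# → ⊥
    from-4 z₀ z₁ z₂ z₃ = irr (Permutation.id , 4 , s≤s z≤n , s≤s (s≤s (s≤s (s≤s (s≤s z≤n)))) , block)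
      where
      block : ∀ i j → 4 ℕ.≤ toℕ i → toℕ j ℕ.< 4 → C i j ≈ 0#
      block 4F 0F (s≤s _) (s≤s _) = z₀
      block 4F 1F (s≤s _) (s≤s _) = z₁
      block 4F 2F (s≤s _) (s≤s _) = z₂
      block 4F 3F (s≤s _) (s≤s _) = z₃
      block 1F _ (s≤s ()) _
      block 2F _ (s≤s (s≤s ())) _
      block 3F _ (s≤s (s≤s (s≤s ()))) _
      block _ 4F _ (s≤s (s≤s (s≤s (s≤s ()))))

    from-34 : C 3F 0F ≈ 0# → C 3F 1F ≈ 0# → C 3F 2F ≈ 0# →
              C 4F 0F ≈ 0# → C 4F 1F ≈ 0# → C 4F 2F ≈ 0# → ⊥
    from-34 z₃₀ z₃₁ z₃₂ z₄₀ z₄₁ z₄₂ = irr (Permutation.id , 3 , s≤s z≤n , s≤s (s≤s (s≤s (s≤s z≤n))) , block)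
      where
      block : ∀ i j → 3 ℕ.≤ toℕ i → toℕ j ℕ.< 3 → C i j ≈ 0#
      block 3F 0F (s≤s _) (s≤s _) = z₃₀
      block 3F 1F (s≤s _) (s≤s _) = z₃₁
      block 3F 2F (s≤s _) (s≤s _) = z₃₂
      block 4F 0F (s≤s _) (s≤s _) = z₄₀
      block 4F 1F (s≤s _) (s≤s _) = z₄₁
      block 4F 2F (s≤s _) (s≤s _) = z₄₂
      block 1F _ (s≤s ()) _
      block 2F _ (s≤s (s≤s ())) _
      block _ 3F _ (s≤s (s≤s (s≤s ())))
      block _ 4F _ (s≤s (s≤s (s≤s ())))

    from-234 : C 2F 0F ≈ 0# → C 2F 1F ≈ 0# → C 3F 0F ≈ 0# → C 3F 1F ≈ 0# →
               C 4F 0F ≈ 0# → C 4F 1F ≈ 0# → ⊥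
    from-234 z₂₀ z₂₁ z₃₀ z₃₁ z₄₀ z₄₁ = irr (Permutation.id , 2 , s≤s z≤n , s≤s (s≤s (s≤s z≤n)) , block)
      where
      block : ∀ i j → 2 ℕ.≤ toℕ i → toℕ j ℕ.< 2 → C i j ≈ 0#
      block 2F 0F (s≤s _) (s≤s _) = z₂₀
      block 2F 1F (s≤s _) (s≤s _) = z₂₁
      block 3F 0F (s≤s _) (s≤s _) = z₃₀
      block 3F 1F (s≤s _) (s≤s _) = z₃₁
      block 4F 0F (s≤s _) (s≤s _) = z₄₀
      block 4F 1F (s≤s _) (s≤s _) = z₄₁
      block 1F _ (s≤s ()) _
      block _ 2F _ (s≤s (s≤s ()))
      block _ 3F _ (s≤s (s≤s ()))
      block _ 4F _ (s≤s (s≤s ()))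

  private module CR = Cycles rawRing

  Acyclic : Matrix 5 → Set ℓ₁
  Acyclic C = All (λ is → CR.cycle C is ≈ 0#) crossingCycles

  ≈0-by : ∀ {x} → (¬ (x ≈ 0#) → ⊥) → x ≈ 0#
  ≈0-by {x} = decidable-stable (x ≟ 0#)

  -- Each arc out of the set of vertices reached so far either closes a
  -- crossing cycle or reaches a new vertex.
  explore-3 : ∀ C → Irreducible C → Acyclic C → ¬ (C 1F 0F ≈ 0#) →
              ¬ (C 0F 4F ≈ 0#) → ¬ (C 4F 3F ≈ 0#) → ¬ (C 3F 2F ≈ 0#) ⊎ ¬ (C 4F 2F ≈ 0#) → ⊥
  explore-3 C irr (c₀₄ ∷ c₀₄₁ ∷ c₀₄₃ ∷ c₀₄₃₁ ∷ c₀₄₂ ∷ c₀₄₂₁ ∷ c₀₄₃₂ ∷ c₀₄₃₂₁ ∷ []) a₁₀ a₀₄ a₄₃ reach-2 =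
    Escape.from-234 C irr
      (≈0-by λ a₂₀ → close₂₀ a₂₀ reach-2)
      (≈0-by λ a₂₁ → close₂₁ a₂₁ reach-2)
      (≈0-by λ a₃₀ → *-≉0 a₀₄ (*-≉0 a₄₃ a₃₀) c₀₄₃)
      (≈0-by λ a₃₁ → *-≉0 a₀₄ (*-≉0 a₄₃ (*-≉0 a₃₁ a₁₀)) c₀₄₃₁)
      (≈0-by λ a₄₀ → *-≉0 a₀₄ a₄₀ c₀₄)
      (≈0-by λ a₄₁ → *-≉0 a₀₄ (*-≉0 a₄₁ a₁₀) c₀₄₁)
    where
    close₂₀ : ¬ (C 2F 0F ≈ 0#) → ¬ (C 3F 2F ≈ 0#) ⊎ ¬ (C 4F 2F ≈ 0#) → ⊥
    close₂₀ a₂₀ (inj₁ a₃₂) = *-≉0 a₀₄ (*-≉0 a₄₃ (*-≉0 a₃₂ a₂₀)) c₀₄₃₂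
    close₂₀ a₂₀ (inj₂ a₄₂) = *-≉0 a₀₄ (*-≉0 a₄₂ a₂₀) c₀₄₂
    close₂₁ : ¬ (C 2F 1F ≈ 0#) → ¬ (C 3F 2F ≈ 0#) ⊎ ¬ (C 4F 2F ≈ 0#) → ⊥
    close₂₁ a₂₁ (inj₁ a₃₂) = *-≉0 a₀₄ (*-≉0 a₄₃ (*-≉0 a₃₂ (*-≉0 a₂₁ a₁₀))) c₀₄₃₂₁
    close₂₁ a₂₁ (inj₂ a₄₂) = *-≉0 a₀₄ (*-≉0 a₄₂ (*-≉0 a₂₁ a₁₀)) c₀₄₂₁

  explore-2 : ∀ C → Irreducible C → Acyclic C → ¬ (C 1F 0F ≈ 0#) →
              ¬ (C 0F 4F ≈ 0#) → ¬ (C 4F 3F ≈ 0#) → ⊥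
  explore-2 C irr acyclic@(c₀₄ ∷ c₀₄₁ ∷ c₀₄₃ ∷ c₀₄₃₁ ∷ _) a₁₀ a₀₄ a₄₃ =
    Escape.from-34 C irr
      (≈0-by λ a₃₀ → *-≉0 a₀₄ (*-≉0 a₄₃ a₃₀) c₀₄₃)
      (≈0-by λ a₃₁ → *-≉0 a₀₄ (*-≉0 a₄₃ (*-≉0 a₃₁ a₁₀)) c₀₄₃₁)
      (≈0-by λ a₃₂ → explore-3 C irr acyclic a₁₀ a₀₄ a₄₃ (inj₁ a₃₂))
      (≈0-by λ a₄₀ → *-≉0 a₀₄ a₄₀ c₀₄)
      (≈0-by λ a₄₁ → *-≉0 a₀₄ (*-≉0 a₄₁ a₁₀) c₀₄₁)
      (≈0-by λ a₄₂ → explore-3 C irr acyclic a₁₀ a₀₄ a₄₃ (inj₂ a₄₂))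

  -- Suppose that 0 → 4 is an arc. A path from 4 through 2 and 3 cannot end in 0 or 1, since 1 → 0
  -- is an arc and a crossing cycle of nonzero weight would close. Irreducibility then forces ever
  -- more vertices to be reached until none is left. The first one after 4 may be called 3, hence
  -- the exchange of 2 and 3.
  explore-1 : ∀ C → Irreducible C → (∀ e → Acyclic (relabel (swap₂₃ e) C)) → ¬ (C 1F 0F ≈ 0#) →
              C 0F 4F ≈ 0#
  explore-1 C irr acyclic a₁₀ = ≈0-by λ a₀₄ → closed a₀₄ (acyclic 0F)
    where
    closed : ¬ (C 0F 4F ≈ 0#) → Acyclic C → ⊥
    closed a₀₄ acyclic₀@(c₀₄ ∷ c₀₄₁ ∷ _) = Escape.from-4 C irr
      (≈0-by λ a₄₀ → *-≉0 a₀₄ a₄₀ c₀₄)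
      (≈0-by λ a₄₁ → *-≉0 a₀₄ (*-≉0 a₄₁ a₁₀) c₀₄₁)
      (≈0-by λ a₄₂ → explore-2 (relabel (swap₂₃ 1F) C) (irreducible-relabel {C} (swap₂₃ 1F) irr)
        (acyclic 1F) a₁₀ a₀₄ a₄₂)
      (≈0-by λ a₄₃ → explore-2 C irr acyclic₀ a₁₀ a₀₄ a₄₃)

  path-relabel : ∀ (A : Matrix 5) τ i j is →
    CR.path (relabel τ A) i j is ≡ CR.path A (τ ⟨$⟩ʳ i) (τ ⟨$⟩ʳ j) (relabelled τ is)
  path-relabel A τ i j []       = refl
  path-relabel A τ i j (k ∷ is) = ≡.cong (A (τ ⟨$⟩ʳ i) (τ ⟨$⟩ʳ k) *_) (path-relabel A τ k j is)

  cycle-relabel : ∀ (A : Matrix 5) τ is → CR.cycle (relabel τ A) is ≡ CR.cycle A (relabelled τ is)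
  cycle-relabel A τ []       = refl
  cycle-relabel A τ (i ∷ is) = path-relabel A τ i i is

  module _ (A : Matrix 5) (0≤A : NonNegative A) (diagonal≈0 : ∀ i → A i i ≈ 0#) where
    open HollowMatrix ℝ A 0≤A diagonal≈0

    path-nonNeg : ∀ i j is → 0# ≤ path i j is
    path-nonNeg i j []       = 0≤A i j
    path-nonNeg i j (k ∷ is) = *-nonNeg (0≤A i k) (path-nonNeg k j is)

    cycle-nonNeg : ∀ is → 0# ≤ cycle is
    cycle-nonNeg []       = 0≤1
    cycle-nonNeg (i ∷ is) = path-nonNeg i i is

    path-eval : ∀ i j is → ⟦_⟧ᶠ ρ (FC.path i j is) ≈ path i j is
    path-eval i j []       = generic-eval i j
    path-eval i j (k ∷ is) = trans (⊗-sound ρ (generic i k) (FC.path k j is))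
      (*-cong (generic-eval i k) (path-eval k j is))

    cycle-eval : ∀ is → ⟦_⟧ᶠ ρ (FC.cycle is) ≈ cycle is
    cycle-eval []       = one-sound ρ
    cycle-eval (i ∷ is) = path-eval i i is

    -- The cycle is squeezed between zero and the vanishing value of `f`.
    dominated-vanishes : ∀ f is → ⟦_⟧ᶠ ρ f ≈ 0# → T (dominates f is) → cycle is ≈ 0#
    dominated-vanishes f is f≈0 h = nonNeg∧nonPos⇒≈0 (cycle-nonNeg is)
      (≤-respʳ-≈ (trans (⊕-sound ρ f (⊖ FC.cycle is))
                   (trans (+-cong f≈0 (trans (⊖-sound ρ (FC.cycle is)) (-‿cong (cycle-eval is))))
                          (+-identityˡ _)))
        (form-nonNeg ρ 0≤ρ (f ⊕ (⊖ FC.cycle is)) h))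

    acyclic-relabel : ∀ f τ → ⟦_⟧ᶠ ρ f ≈ 0# → T (all (λ is → dominates f (relabelled τ is)) crossingCycles) →
                      Acyclic (relabel τ A)
    acyclic-relabel f τ f≈0 h = All.map
      (λ {is} h → trans (reflexive (cycle-relabel A τ is)) (dominated-vanishes f (relabelled τ is) f≈0 h))
      (all⁺ (λ is → dominates f (relabelled τ is)) crossingCycles h)

    module _ (crossing≈0 : ⟦_⟧ᶠ ρ (normalise :crossing) ≈ 0#)
             (a₀₁ : ¬ (A 0F 1F ≈ 0#)) (a₁₀ : ¬ (A 1F 0F ≈ 0#)) (irr : Irreducible A) where

      acyclic : ∀ i x e → Acyclic (relabel (swap₂₃ e) (relabel (arcLabel i x) A))
      acyclic i x e = acyclic-relabel (normalise :crossing) (fullLabel i x e) crossing≈0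
        (dominatesAll-sound (normalise :crossing) crossing-dominatesAll i x e)

      no-arc : ∀ i x → ¬ (relabel (arcLabel i x) A 1F 0F ≈ 0#) → relabel (arcLabel i x) A 0F 4F ≈ 0#
      no-arc i x = explore-1 (relabel (arcLabel i x) A) (irreducible-relabel {A} (arcLabel i x) irr) (acyclic i x)

      crossing-reducible : ⊥
      crossing-reducible = Escape.from-34 (relabel π A) (irreducible-relabel {A} π irr)
        (no-arc 0F 1F a₁₀) (no-arc 0F 2F a₁₀) (no-arc 0F 0F a₁₀)
        (no-arc 1F 1F a₀₁) (no-arc 1F 2F a₀₁) (no-arc 1F 0F a₀₁)
        where
        π : Permutation′ 5
        -- Positions 3 and 4 now hold the vertices 0 and 1, from which no arc leads to the other
        -- three.
        π = transpose 0F 3F ∘ₚ transpose 1F 4F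

-- Necessary conditions

module Necessity {c ℓ₁ ℓ₂} (ℝ : Reals c ℓ₁ ℓ₂) where
  open Reals ℝ
  open OrderedField ℝ
  open Realizability ℝ using (Matrix; NonNegative; Irreducible; Poly; _≈ₚ_; quintic)
  open Normalisation ℝ
  open RawSemiringDefinitions (RawRing.rawSemiring rawRing) using (sum)

  HasCoeffs : ∀ {n} → Matrix n → Poly → Set ℓ₁
  HasCoeffs A P = ∀ k → charCoeff rawRing A k ≈ Polynomials.coeff rawRing P k

  -- Stated for all n because the conversion check between the two forms of the
  -- characteristic polynomial is then immediate.
  unseal : ∀ n P → Realizability.Realizable ℝ n P → Σ[ A ∈ Matrix n ] NonNegative A × HasCoeffs A P
  unseal n P (A , 0≤A , eq) = A , 0≤A , ≡.subst (λ p → p ≈ₚ P) (≡.sym (proj₂ (sealed rawRing A))) eq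

  unseal-irreducible : ∀ n P → Realizability.IrreduciblyRealizable ℝ n P →
                       Σ[ A ∈ Matrix n ] NonNegative A × Irreducible A × HasCoeffs A P
  unseal-irreducible n P (A , 0≤A , irr , eq) =
    A , 0≤A , irr , ≡.subst (λ p → p ≈ₚ P) (≡.sym (proj₂ (sealed rawRing A))) eq

  seal-irreducible : ∀ n P → Σ[ A ∈ Matrix n ] NonNegative A × Irreducible A × HasCoeffs A P →
                     Realizability.IrreduciblyRealizable ℝ n P
  seal-irreducible n P (A , 0≤A , irr , eq) =
    A , 0≤A , irr , ≡.subst (λ p → p ≈ₚ P) (proj₂ (sealed rawRing A)) eq

  irreduciblyRealizable⇒realizable : ∀ n P → Realizability.IrreduciblyRealizable ℝ n P →
                                     Realizability.Realizable ℝ n P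
  irreduciblyRealizable⇒realizable n P (A , 0≤A , _ , eq) = A , 0≤A , eq

  record Normal (k₂ k₃ k₄ k₅ : Carrier) (A : Matrix 5) : Set (c ⊔ ℓ₁ ⊔ ℓ₂) where
    field
      nonNegative : NonNegative A
      diagonal≈0  : Diagonal≈0 A
      coeffs      : ∀ n → charCoeff rawRing A n ≈ Polynomials.coeff rawRing (quintic k₂ k₃ k₄ k₅) n
      maximal     : Maximal₀₁ A

  normal-form : ∀ {k₂ k₃ k₄ k₅} (A : Matrix 5) → NonNegative A → HasCoeffs A (quintic k₂ k₃ k₄ k₅) →
                ∃[ τ ] Normal k₂ k₃ k₄ k₅ (relabel τ A)
  normal-form {k₂} {k₃} {k₄} {k₅} A 0≤A coeffs-A =
    let (τ , coeffs-τ , max) = normalisation A 0≤A diagonal in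
    τ , record
      { nonNegative = λ _ _ → 0≤A _ _
      ; diagonal≈0  = λ _ → diagonal _
      ; coeffs      = λ n → trans (coeffs-τ n) (coeffs-A n)
      ; maximal     = max
      }
    where
    diagonal : Diagonal≈0 A
    diagonal = NonNegativeMatrix.coeff₄≈0⇒diagonal≈0 ℝ A 0≤A (coeffs-A 4)

  -- P = (x² − a)(x³ − b x − q) − f x − g.
  record Factors (k₂ k₃ k₄ k₅ : Carrier) : Set (c ⊔ ℓ₁ ⊔ ℓ₂) where
    field
      a b q f g : Carrier
      0≤b : 0# ≤ b
      b≤a : 0# ≤ a - b
      0≤q : 0# ≤ q
      0≤f : 0# ≤ f
      0≤g : 0# ≤ g
      k₂≈ : k₂ ≈ - (a + b)
      k₃≈ : k₃ ≈ - q
      k₄≈ : k₄ ≈ a * b - f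
      k₅≈ : k₅ ≈ a * q - g

    0≤a : 0# ≤ a
    0≤a = ≤-respʳ-≈ (solve (a ▷ b ▷ ∅) ((v₀ ⊟ v₁) :+ v₁) v₀ refl) (+-nonNeg b≤a 0≤b)

  module NormalBounds {k₂ k₃ k₄ k₅ : Carrier} {A : Matrix 5} (normal : Normal k₂ k₃ k₄ k₅ A) where
    open Normal normal
    open HollowMatrix ℝ A nonNegative diagonal≈0 public
    open PetersenBounds ℝ weight weight-nonNeg public
      using (heavy-edge-bound; motzkin-straus; motzkin-straus-equality)

    negate : ∀ {x k} → k ≈ - x → x ≈ - k
    negate {x} {k} k≈-x = trans (solve (x ▷ ∅) v₀ (:- :- v₀) refl) (-‿cong (sym k≈-x))

    p≈-k₂ : p ≈ - k₂
    p≈-k₂ = negate (trans (sym (coeffs 3)) coeff₃)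

    triangles≈-k₃ : triangles ≈ - k₃
    triangles≈-k₃ = negate (trans (sym (coeffs 2)) coeff₂)

    k₄≤matching : 0# ≤ matching - k₄
    k₄≤matching = ≤-respʳ-≈ (+-congˡ (-‿cong (coeffs 1))) coeff₁

    k₅≤edge-triangles : 0# ≤ edge-triangles - k₅
    k₅≤edge-triangles = ≤-respʳ-≈ (+-congˡ (-‿cong (coeffs 0))) coeff₀

    weight≤ : ∀ k → 0# ≤ weight 0F - weight k
    weight≤ k = ≤⇒0≤- (maximal (proj₁ (ends k)) (proj₂ (ends k)))

    distance-nonNeg : ∀ k → 0# ≤ (weight 0F - weight k) * triangle k
    distance-nonNeg k = *-nonNeg (weight≤ k) (triangle-nonNeg k)

    edge-triangles≤ : 0# ≤ weight 0F * triangles - edge-triangles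
    edge-triangles≤ = ≤-respʳ-≈ (sum-distance (weight 0F) weight triangle) (sum-nonNeg distance-nonNeg)

    0≤triangles : 0# ≤ triangles
    0≤triangles = sum-nonNeg triangle-nonNeg

    factors-from : ∀ a b → 0# ≤ b → 0# ≤ a - b → p ≈ a + b → 0# ≤ a * b - matching →
                   0# ≤ a * triangles - edge-triangles → Factors k₂ k₃ k₄ k₅
    factors-from a b 0≤b b≤a p≈a+b D≤ab E≤aq = record
      { a = a ; b = b ; q = triangles ; f = a * b - k₄ ; g = a * triangles - k₅
      ; 0≤b = 0≤b ; b≤a = b≤a ; 0≤q = 0≤triangles
      ; 0≤f = ≤-respʳ-≈ (chain (a * b) matching k₄) (+-nonNeg D≤ab k₄≤matching)
      ; 0≤g = ≤-respʳ-≈ (chain (a * triangles) edge-triangles k₅) (+-nonNeg E≤aq k₅≤edge-triangles)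
      ; k₂≈ = trans (negate p≈-k₂) (-‿cong p≈a+b)
      ; k₃≈ = negate triangles≈-k₃
      ; k₄≈ = residue (a * b) k₄
      ; k₅≈ = residue (a * triangles) k₅
      }
      where
      chain : ∀ x y z → (x - y) + (y - z) ≈ x - z
      chain x y z = solve (x ▷ y ▷ z ▷ ∅) ((v₀ ⊟ v₁) :+ (v₁ ⊟ v₂)) (v₀ ⊟ v₂) refl
      residue : ∀ x y → y ≈ x - (x - y)
      residue x y = solve (x ▷ y ▷ ∅) v₁ (v₀ ⊟ (v₀ ⊟ v₁)) refl

    w₀ : Carrier
    w₀ = weight 0F

    factors : Factors k₂ k₃ k₄ k₅
    factors with 0# ≤? (w₀ + w₀ - p)
    -- The heaviest 2-cycle carries at least half of `p`: a = w₀ and b = p - w₀, with the squares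
    -- subtracted in `excess` added back.
    ... | yes p≤2w₀ = factors-from w₀ (p - w₀)
      (≤⇒0≤- (term≤sum weight-nonNeg 0F))
      (≤-respʳ-≈ (solve (w₀ ▷ p ▷ ∅) (v₀ :+ v₀ ⊟ v₁) (v₀ ⊟ (v₁ ⊟ v₀)) refl) p≤2w₀)
      (solve (w₀ ▷ p ▷ ∅) v₁ (v₀ :+ (v₁ ⊟ v₀)) refl)
      (≤-respʳ-≈
        (solve (w₀ ▷ p ▷ matching ▷ s₀ ▷ s₁ ▷ ∅)
          ((v₀ :* (v₁ ⊟ v₀) ⊟ v₂ ⊟ (v₀ ⊟ v₀) :* (v₀ ⊟ v₀) ⊟ v₃ :* v₃ ⊟ :var 4 :* :var 4)
            :+ (v₃ :* v₃ :+ :var 4 :* :var 4))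
          (v₀ :* (v₁ ⊟ v₀) ⊟ v₂) refl)
        (+-nonNeg
          (heavy-edge-bound w₀ (≤-reflexive (sym (-‿inverseʳ w₀))) p≤2w₀)
          (+-nonNeg (square-nonNeg s₀) (square-nonNeg s₁))))
      edge-triangles≤
    -- Otherwise a = b = p/2, and w₀ ≤ a enlarges the bound w₀ q on E to a q.
    ... | no  p≰2w₀ = factors-from a a 0≤a (≤-reflexive (sym (-‿inverseʳ a))) p≈a+a
      (motzkin-straus a p≈a+a 0≤a a≉0)
      (≤-respʳ-≈
        (solve (a ▷ w₀ ▷ triangles ▷ edge-triangles ▷ ∅)
          ((v₀ ⊟ v₁) :* v₂ :+ (v₁ :* v₂ ⊟ v₃)) (v₀ :* v₂ ⊟ v₃) refl)
        (+-nonNeg (*-nonNeg w₀≤a 0≤triangles) edge-triangles≤))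
      where
      a : Carrier
      a = p * ½
      0≤a : 0# ≤ a
      0≤a = *-nonNeg (sum-nonNeg weight-nonNeg) 0≤½
      p≈a+a : p ≈ a + a
      p≈a+a = sym (halves p)
      w₀≤a : 0# ≤ a - w₀
      w₀≤a = ≤-respʳ-≈
        (trans (solve (w₀ ▷ p ▷ ½ ▷ ∅) ((:- (v₀ :+ v₀ ⊟ v₁)) :* v₂) (v₁ :* v₂ ⊟ (v₀ :* v₂ :+ v₀ :* v₂)) refl)
               (+-congˡ (-‿cong (halves w₀))))
        (*-nonNeg (≰0⇒0≤ p≰2w₀) 0≤½)
      a≉0 : ¬ (a ≈ 0#)
      -- If `p` were zero, then w₀ ≥ 0 would already be at least p/2.
      a≉0 a≈0 = p≰2w₀ (≤-respʳ-≈ (trans (sym (+-identityʳ _)) (+-congˡ (trans (solve ∅ :0 (:- (:0 :+ :0)) refl)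
          (-‿cong (trans (sym (+-cong a≈0 a≈0)) (sym p≈a+a))))))
        (+-nonNeg (weight-nonNeg 0F) (weight-nonNeg 0F)))

  realizable⇒factors : ∀ {k₂ k₃ k₄ k₅} → Realizability.Realizable ℝ 5 (quintic k₂ k₃ k₄ k₅) →
                       Factors k₂ k₃ k₄ k₅
  realizable⇒factors {k₂} {k₃} {k₄} {k₅} r =
    let (A , 0≤A , coeffs-A) = unseal 5 (quintic k₂ k₃ k₄ k₅) r in
    NormalBounds.factors (proj₂ (normal-form {k₂} {k₃} {k₄} {k₅} A 0≤A coeffs-A))

-- The exceptional polynomials

module Obstruction {c ℓ₁ ℓ₂} (ℝ : Reals c ℓ₁ ℓ₂) where
  open Reals ℝ
  open OrderedField ℝ
  open Realizability ℝ using (Matrix; NonNegative; Irreducible; quintic)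
  open Normalisation ℝ
  open Connectivity ℝ
  open Necessity ℝ
  open RawSemiringDefinitions (RawRing.rawSemiring rawRing) using (sum)
  open import Relation.Binary.Reasoning.Setoid setoid

  record Critical (k₂ k₃ k₄ k₅ : Carrier) : Set (c ⊔ ℓ₁ ⊔ ℓ₂) where
    field
      a b q : Carrier
      0≤a : 0# ≤ a
      a≉0 : ¬ (a ≈ 0#)
      b≤a : 0# ≤ a - b
      0≤q : 0# ≤ q
      k₂≈ : k₂ ≈ - (a + b)
      k₃≈ : k₃ ≈ - q
      k₄≈ : k₄ ≈ a * b
      k₅≈ : k₅ ≈ a * q
      boundary : ¬ (q ≈ 0#) × ¬ (a - b ≈ 0#) ⊎ q ≈ 0# × a ≈ b

  module _ {k₂ k₃ k₄ k₅ : Carrier} (critical : Critical k₂ k₃ k₄ k₅)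
           {A : Matrix 5} (normal : Normal k₂ k₃ k₄ k₅ A) where
    open Critical critical
    open Normal normal using (nonNegative; diagonal≈0; coeffs)
    open NormalBounds normal

    p≈a+b : p ≈ a + b
    p≈a+b = trans p≈-k₂ (trans (-‿cong k₂≈) (solve (a + b ▷ ∅) (:- :- v₀) v₀ refl))

    triangles≈q : triangles ≈ q
    triangles≈q = trans triangles≈-k₃ (trans (-‿cong k₃≈) (solve (q ▷ ∅) (:- :- v₀) v₀ refl))

    -- For q ≠ 0, w₀ q ≥ E ≥ k₅ = a q, and q can be cancelled. For a = b, D ≥ k₄ = a² is the
    -- equality case of Motzkin-Straus.
    heavy : 0# ≤ w₀ - a
    heavy with boundary
    ... | inj₁ (q≉0 , _) = *-cancelˡ-nonNeg 0≤q q≉0 (≤-respʳ-≈ (begin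
      (w₀ * triangles - edge-triangles) + (edge-triangles - k₅)
        ≈⟨ +-cong (+-congʳ (*-congˡ triangles≈q)) (+-congˡ (-‿cong k₅≈)) ⟩
      (w₀ * q - edge-triangles) + (edge-triangles - a * q)
        ≈⟨ solve (w₀ ▷ q ▷ edge-triangles ▷ a ▷ ∅)
             ((v₀ :* v₁ ⊟ v₂) :+ (v₂ ⊟ v₃ :* v₁)) (v₁ :* (v₀ ⊟ v₃)) refl ⟩
      q * (w₀ - a) ∎)
      (+-nonNeg edge-triangles≤ k₅≤edge-triangles))
    ... | inj₂ (_ , a≈b) = motzkin-straus-equality a (trans p≈a+b (+-congˡ (sym a≈b))) 0≤a a≉0
      (≤-respʳ-≈ (+-congˡ (-‿cong (trans k₄≈ (*-congˡ (sym a≈b))))) k₄≤matching) weight≤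

    private
      x y z u : Carrier
      x = matching - k₄
      y = (w₀ - a) * (w₀ - a)
      z = s₀ * s₀
      u = s₁ * s₁
      0≤y : 0# ≤ y
      0≤y = square-nonNeg (w₀ - a)
      0≤z : 0# ≤ z
      0≤z = square-nonNeg s₀
      0≤u : 0# ≤ u
      0≤u = square-nonNeg s₁

      -- Since a (p - a) = a b = k₄, the heavy-edge bound says that four nonnegative numbers have a
      -- sum of at most zero.
      total≤0 : 0# ≤ - (x + y + z + u)
      total≤0 = ≤-respʳ-≈ (begin
        a * (p - a) - matching - y - z - u
          ≈⟨ +-congʳ (+-congʳ (+-congʳ (+-congʳ (*-congˡ (+-congʳ p≈a+b))))) ⟩
        a * (a + b - a) - matching - y - z - u
          ≈⟨ solve (a ▷ b ▷ matching ▷ y ▷ z ▷ u ▷ ∅)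
               (v₀ :* (v₀ :+ v₁ ⊟ v₀) ⊟ v₂ ⊟ v₃ ⊟ :var 4 ⊟ :var 5)
               (:- ((v₂ ⊟ v₀ :* v₁) :+ v₃ :+ :var 4 :+ :var 5)) refl ⟩
        - ((matching - a * b) + y + z + u)
          ≈⟨ -‿cong (+-congʳ (+-congʳ (+-congʳ (+-congˡ (-‿cong k₄≈))))) ⟨
        - (x + y + z + u) ∎)
        (heavy-edge-bound a heavy (≤-respʳ-≈ (trans
          (solve (a ▷ b ▷ ∅) (v₀ ⊟ v₁) (v₀ :+ v₀ ⊟ (v₀ :+ v₁)) refl)
          (+-congˡ (-‿cong (sym p≈a+b)))) b≤a))

      parts : Fin 4 → Carrier
      parts 0F = x
      parts 1F = y
      parts 2F = z
      parts 3F = u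

      parts≈0 : ∀ i → parts i ≈ 0#
      parts≈0 = sum≈0⇒≈0 parts
        (λ { 0F → k₄≤matching ; 1F → 0≤y ; 2F → 0≤z ; 3F → 0≤u })
        (≤-respʳ-≈ (solve (x ▷ y ▷ z ▷ u ▷ ∅)
          (:- (v₀ :+ v₁ :+ v₂ :+ v₃)) (:- (v₀ :+ (v₁ :+ (v₂ :+ (v₃ :+ :0))))) refl) total≤0)

    w₀≈a : w₀ - a ≈ 0#
    w₀≈a = square≈0 (parts≈0 1F)

    -- Both quantities are nonnegative, and they add up to (w₀ - a) q, which is zero.
    k₅-excess≈0 : edge-triangles - k₅ ≈ 0# × sum (λ k → (w₀ - weight k) * triangle k) ≈ 0#
    k₅-excess≈0 = summandˡ≈0 k₅≤edge-triangles (sum-nonNeg distance-nonNeg) (≤-reflexive both)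
                , summandˡ≈0 (sum-nonNeg distance-nonNeg) k₅≤edge-triangles (≤-reflexive (trans both
                    (solve (edge-triangles - k₅ ▷ sum (λ k → (w₀ - weight k) * triangle k) ▷ ∅)
                       (:- (v₀ :+ v₁)) (:- (v₁ :+ v₀)) refl)))
      where
      both : 0# ≈ - ((edge-triangles - k₅) + sum (λ k → (w₀ - weight k) * triangle k))
      both = sym (begin
        - ((edge-triangles - k₅) + sum (λ k → (w₀ - weight k) * triangle k))
          ≈⟨ -‿cong (+-cong (+-congˡ (-‿cong k₅≈)) (trans (sum-distance w₀ weight triangle) (+-congʳ (*-congˡ triangles≈q)))) ⟩
        - ((edge-triangles - a * q) + (w₀ * q - edge-triangles))
          ≈⟨ solve (edge-triangles ▷ a ▷ q ▷ w₀ ▷ ∅)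
               (:- ((v₀ ⊟ v₁ :* v₂) :+ (v₃ :* v₂ ⊟ v₀))) ((:- v₂) :* (v₃ ⊟ v₁)) refl ⟩
        - q * (w₀ - a)    ≈⟨ *-congˡ w₀≈a ⟩
        - q * 0#          ≈⟨ zeroʳ _ ⟩
        0#                ∎)

    distance-triangle≈0 : ∀ k → (w₀ - weight k) * triangle k ≈ 0#
    distance-triangle≈0 = sum≈0⇒≈0 _ distance-nonNeg
      (≤-reflexive (trans (sym -0≈0) (-‿cong (sym (proj₂ k₅-excess≈0)))))

    -- For q = 0 there are no 3-cycles of nonzero weight. For b < a, a second 2-cycle of weight w₀ =
    -- a would make p at least 2a, more than a + b, so the factor w₀ - w of every other 2-cycle can
    -- be cancelled.
    other-triangle≈0 : ∀ k → triangle (suc k) ≈ 0#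
    other-triangle≈0 k with boundary
    ... | inj₂ (q≈0 , _) = sum≈0⇒≈0 triangle triangle-nonNeg
      (≤-reflexive (trans (sym -0≈0) (-‿cong (sym (trans triangles≈q q≈0))))) (suc k)
    ... | inj₁ (_ , a≉b) = *-cancelˡ-≈0 {x = w₀ - weight (suc k)}
      (λ same → a≉b (nonNeg∧nonPos⇒≈0 b≤a (≤-respʳ-≈ (begin
        (p - w₀) - weight (suc k)
          ≈⟨ +-congʳ (+-congʳ p≈a+b) ⟩
        (a + b - w₀) - weight (suc k)
          ≈⟨ solve (a ▷ b ▷ w₀ ▷ weight (suc k) ▷ ∅) (v₀ :+ v₁ ⊟ v₂ ⊟ v₃)
               (:- (v₀ ⊟ v₁) ⊟ ((v₂ ⊟ v₀) :+ (v₂ ⊟ v₀)) :+ (v₂ ⊟ v₃)) refl ⟩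
        - (a - b) - ((w₀ - a) + (w₀ - a)) + (w₀ - weight (suc k))
          ≈⟨ +-cong (+-congˡ (-‿cong (+-cong w₀≈a w₀≈a))) same ⟩
        - (a - b) - (0# + 0#) + 0#
          ≈⟨ solve (a - b ▷ ∅) (:- v₀ ⊟ (:0 :+ :0) :+ :0) (:- v₀) refl ⟩
        - (a - b) ∎)
        (≤⇒0≤- (≤-respʳ-≈ (solve (w₀ ▷ sum (λ k → weight (suc k)) ▷ ∅) v₁ ((v₀ :+ v₁) ⊟ v₀) refl)
          (term≤sum (λ k → weight-nonNeg (suc k)) k))))))
      (distance-triangle≈0 (suc k))

    crossing≈0 : ⟦_⟧ᶠ ρ (normalise :crossing) ≈ 0#
    crossing≈0 = begin
      ⟦_⟧ᶠ ρ (normalise :crossing)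
        ≈⟨ normalise-sound ρ :crossing ⟩
      s₀ + s₁ + (triangles - triangle 0F)
        + (matching - ⟦_⟧ᶠ ρ (charCoeff formRawRing hollow 1))
        + (edge-triangles - ⟦_⟧ᶠ ρ (charCoeff formRawRing hollow 0))
        ≈⟨ +-cong (+-cong (+-cong (+-cong (square≈0 (parts≈0 2F)) (square≈0 (parts≈0 3F)))
             (trans (solve (triangle 0F ▷ sum (λ k → triangle (suc k)) ▷ ∅) ((v₀ :+ v₁) ⊟ v₀) v₁ refl)
                    (≈0⇒sum≈0 other-triangle≈0)))
             (trans (+-congˡ (-‿cong (trans (sym (coeff-eval 1)) (coeffs 1)))) (parts≈0 0F)))
             (trans (+-congˡ (-‿cong (trans (sym (coeff-eval 0)) (coeffs 0)))) (proj₁ k₅-excess≈0)) ⟩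
      0# + 0# + 0# + 0# + 0#
        ≈⟨ solve ∅ (:0 :+ :0 :+ :0 :+ :0 :+ :0) :0 refl ⟩
      0# ∎

    w₀≉0 : ¬ (w₀ ≈ 0#)
    w₀≉0 w₀≈0 = a≉0 (begin
      a                ≈⟨ solve (a ▷ w₀ ▷ ∅) v₀ (v₁ ⊟ (v₁ ⊟ v₀)) refl ⟩
      w₀ - (w₀ - a)    ≈⟨ +-cong w₀≈0 (-‿cong w₀≈a) ⟩
      0# - 0#          ≈⟨ solve ∅ (:0 ⊟ :0) :0 refl ⟩
      0#               ∎)

    reducible : ¬ Irreducible A
    reducible = crossing-reducible A nonNegative diagonal≈0 crossing≈0
      (λ z → w₀≉0 (trans (*-congʳ z) (zeroˡ _)))
      (λ z → w₀≉0 (trans (*-congˡ z) (zeroʳ _)))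

  critical⇒¬hasCoeffs : ∀ {k₂ k₃ k₄ k₅} → Critical k₂ k₃ k₄ k₅ →
    ¬ (Σ[ A ∈ Matrix 5 ] NonNegative A × Irreducible A × HasCoeffs A (quintic k₂ k₃ k₄ k₅))
  critical⇒¬hasCoeffs {k₂} {k₃} {k₄} {k₅} critical (A , 0≤A , irr , coeffs-A) =
    let (τ , normal) = normal-form {k₂} {k₃} {k₄} {k₅} A 0≤A coeffs-A in
    reducible critical normal (irreducible-relabel {A} τ irr)

  critical⇒¬irreduciblyRealizable : ∀ {k₂ k₃ k₄ k₅} → Critical k₂ k₃ k₄ k₅ →
    ¬ Realizability.IrreduciblyRealizable ℝ 5 (quintic k₂ k₃ k₄ k₅)
  critical⇒¬irreduciblyRealizable {k₂} {k₃} {k₄} {k₅} critical r =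
    critical⇒¬hasCoeffs critical (unseal-irreducible 5 (quintic k₂ k₃ k₄ k₅) r)

-- Irreducible realizations

module StrongConnectivity {c ℓ₁ ℓ₂} (ℝ : Reals c ℓ₁ ℓ₂) where
  open Reals ℝ using (Carrier; _≈_; 0#)
  open Realizability ℝ using (Matrix; Irreducible)

  -- A record, so that the endpoints can be recovered from the type even where the entry reduces.
  record Arc {n} (A : Matrix n) (i j : Fin n) : Set ℓ₁ where
    constructor arc
    field nonZero : ¬ (A i j ≈ 0#)

  -- Under a reducing permutation a walk from a rank of at least `m` never reaches a smaller rank,
  -- but the walk from rank `m` through the hub `h` to rank 0 does.
  stronglyConnected⇒irreducible : ∀ {n} (A : Matrix n) h → (∀ i → Star (Arc A) i h) → (∀ i → Star (Arc A) h i) →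
                                  Irreducible A
  stronglyConnected⇒irreducible {n} A h to-h from-h (π , m , 0<m , m<n , block) =
    ℕ.<⇒≱ (≡.subst (ℕ._< m) (≡.sym (rank-vertex 0<n)) 0<m)
        (stays (to-h _ ◅◅ from-h _) (ℕ.≤-reflexive (≡.sym (rank-vertex m<n))))
    where
    rank : Fin n → ℕ
    rank v = toℕ (π ⟨$⟩ˡ v)

    0<n : 0 ℕ.< n
    0<n = ℕ.<-trans 0<m m<n

    vertex : ∀ {k} → k ℕ.< n → Fin n
    vertex k<n = π ⟨$⟩ʳ fromℕ< k<n

    rank-vertex : ∀ {k} (k<n : k ℕ.< n) → rank (vertex k<n) ≡ k
    rank-vertex k<n = ≡.trans (≡.cong toℕ (Permutation.inverseˡ π)) (Fin.toℕ-fromℕ< k<n)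

    stays-arc : ∀ u v → Arc A u v → m ℕ.≤ rank u → m ℕ.≤ rank v
    stays-arc u v (arc a≉0) m≤u with m ℕ.≤? rank v
    ... | yes m≤v = m≤v
    ... | no  m≰v = contradiction
      (≡.subst₂ (λ x y → A x y ≈ 0#) (Permutation.inverseʳ π) (Permutation.inverseʳ π)
        (block (π ⟨$⟩ˡ u) (π ⟨$⟩ˡ v) m≤u (ℕ.≰⇒> m≰v)))
      a≉0

    stays : ∀ {u v} → Star (Arc A) u v → m ℕ.≤ rank u → m ℕ.≤ rank v
    stays ε          m≤u = m≤u
    stays (a ◅ as) m≤u = stays as (stays-arc _ _ a m≤u)

-- Three sparse matrices

matches : List Form → List Expr → Bool
matches []       []       = true
matches (p ∷ ps) (e ∷ es) = null (p ⊕ (⊖ normalise e)) ∧ matches ps es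
matches _        _        = false

-- In order: the variables a, b, q, f, g.
hamiltonian : SquareMatrices.Matrix formRawRing 5
hamiltonian 0F 1F = one
hamiltonian 1F 2F = one
hamiltonian 2F 3F = one
hamiltonian 3F 4F = one
hamiltonian 1F 0F = var 0
hamiltonian 3F 2F = var 1
hamiltonian 4F 2F = var 2
hamiltonian 3F 0F = var 3
hamiltonian 4F 0F = var 4
hamiltonian _  _  = []

-- Bipartite with vertices 0 and 4 twinned; the variables are a/2, b, f/2.
bipartite : SquareMatrices.Matrix formRawRing 5
bipartite 0F 1F = one
bipartite 4F 1F = one
bipartite 1F 2F = one
bipartite 2F 3F = one
bipartite 1F 0F = var 0
bipartite 1F 4F = var 0
bipartite 3F 2F = var 1
bipartite 3F 0F = var 2
bipartite 3F 4F = var 2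
bipartite _  _  = []

-- Two triangles sharing vertex 4; the variables are a, q/2.
bowtie : SquareMatrices.Matrix formRawRing 5
bowtie 0F 1F = one
bowtie 1F 0F = var 0
bowtie 2F 3F = one
bowtie 3F 2F = var 0
bowtie 1F 4F = one
bowtie 4F 0F = var 1
bowtie 3F 4F = one
bowtie 4F 2F = var 1
bowtie _  _  = []

:quintic : (k₂ k₃ k₄ k₅ : Expr) → List Expr
:quintic k₂ k₃ k₄ k₅ = k₅ ∷ k₄ ∷ k₃ ∷ k₂ ∷ :0 ∷ :1 ∷ []

hamiltonian-coeffs bipartite-coeffs bowtie-coeffs : List Expr
hamiltonian-coeffs = :quintic (:- (:var 0 :+ :var 1)) (:- :var 2)
  (:var 0 :* :var 1 :+ :- :var 3) (:var 0 :* :var 2 :+ :- :var 4)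
bipartite-coeffs = :quintic (:- (:var 0 :+ :var 0 :+ :var 1)) :0
  ((:var 0 :+ :var 0) :* :var 1 :+ :- (:var 2 :+ :var 2)) :0
bowtie-coeffs = :quintic (:- (:var 0 :+ :var 0)) (:- (:var 1 :+ :var 1))
  (:var 0 :* :var 0) (:var 0 :* (:var 1 :+ :var 1))

entriesPositive : SquareMatrices.Matrix formRawRing 5 → Bool
entriesPositive S = every λ i → every λ j → positive (S i j)

opaque
  unfolding sealed

  hamiltonian-matches : T (matches (proj₁ (sealed formRawRing hamiltonian)) hamiltonian-coeffs)
  hamiltonian-matches = tt

  bipartite-matches : T (matches (proj₁ (sealed formRawRing bipartite)) bipartite-coeffs)
  bipartite-matches = tt

  bowtie-matches : T (matches (proj₁ (sealed formRawRing bowtie)) bowtie-coeffs)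
  bowtie-matches = tt

module Construction {c ℓ₁ ℓ₂} (ℝ : Reals c ℓ₁ ℓ₂) where
  open Reals ℝ
  open OrderedField ℝ
  open Realizability ℝ using (Matrix; NonNegative; Irreducible; Poly; quintic)
  open Necessity ℝ
  open StrongConnectivity ℝ

  matches-sound : ∀ ρ ps es → T (matches ps es) → ∀ k →
    ⟦_⟧ᶠ ρ (Polynomials.coeff formRawRing ps k) ≈ Polynomials.coeff rawRing (map (⟦_⟧ ρ) es) k
  matches-sound ρ []       []       _ k       = ≈-refl
  matches-sound ρ (p ∷ ps) (e ∷ es) h zero    = form-identity ρ p e (proj₁ (Equivalence.to T-∧ h))
  matches-sound ρ (p ∷ ps) (e ∷ es) h (suc k) = matches-sound ρ ps es (proj₂ (Equivalence.to T-∧ h)) k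

  IrreducibleMatrix : Poly → Set (c ⊔ ℓ₁ ⊔ ℓ₂)
  IrreducibleMatrix P = Σ[ A ∈ Matrix 5 ] NonNegative A × Irreducible A × HasCoeffs A P

  module Evaluated (ρ : ℕ → Carrier) (0≤ρ : ∀ n → 0# ≤ ρ n) (S : SquareMatrices.Matrix formRawRing 5) where

    matrix : Matrix 5
    matrix i j = ⟦_⟧ᶠ ρ (S i j)

    matrix-nonNeg : T (entriesPositive S) → NonNegative matrix
    matrix-nonNeg h i j = form-nonNeg ρ 0≤ρ (S i j)
      (every-sound (λ j → positive (S i j)) (every-sound (λ i → every λ j → positive (S i j)) h i) j)

    matrix-coeffs : ∀ es → T (matches (proj₁ (sealed formRawRing S)) es) → HasCoeffs matrix (map (⟦_⟧ ρ) es)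
    matrix-coeffs es h k = trans
      (Transfer.charCoeff-eval commutativeRing ρ matrix S (λ _ _ → ≈-refl) k)
      (matches-sound ρ (proj₁ (sealed formRawRing S)) es h k)

    one-arc : ¬ (⟦_⟧ᶠ ρ one ≈ 0#)
    one-arc h = 1≉0 (trans (sym (one-sound ρ)) h)

    var-arc : ∀ x → ¬ (ρ x ≈ 0#) → ¬ (⟦_⟧ᶠ ρ (var x) ≈ 0#)
    var-arc x ρx≉0 h = ρx≉0 (trans (sym (var-sound ρ x)) h)

  env-nonNeg : ∀ {x ρ} → 0# ≤ x → (∀ n → 0# ≤ ρ n) → ∀ n → 0# ≤ (x ▷ ρ) n
  env-nonNeg 0≤x 0≤ρ zero    = 0≤x
  env-nonNeg 0≤x 0≤ρ (suc n) = 0≤ρ n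

  ∅-nonNeg : ∀ n → 0# ≤ ∅ n
  ∅-nonNeg _ = ≤-refl

  module _ {a b q f g : Carrier} (0≤a : 0# ≤ a) (0≤b : 0# ≤ b) (0≤q : 0# ≤ q) (0≤f : 0# ≤ f) (0≤g : 0# ≤ g) where
    private
      ρ : ℕ → Carrier
      ρ = a ▷ b ▷ q ▷ f ▷ g ▷ ∅
      module E = Evaluated ρ
        (env-nonNeg 0≤a (env-nonNeg 0≤b (env-nonNeg 0≤q (env-nonNeg 0≤f (env-nonNeg 0≤g ∅-nonNeg)))))
        hamiltonian

    -- The arc of weight `g` closes the Hamiltonian cycle. Without it, `f` leads back from 3 to 0
    -- and `q` gives vertex 4 a way out.
    hamiltonian-matrix : ¬ (g ≈ 0#) ⊎ ¬ (q ≈ 0#) × ¬ (f ≈ 0#) →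
      IrreducibleMatrix (quintic (- (a + b)) (- q) (a * b - f) (a * q - g))
    hamiltonian-matrix arcs = E.matrix , E.matrix-nonNeg _ , irreducible arcs ,
      E.matrix-coeffs hamiltonian-coeffs hamiltonian-matches
      where
      a₀₁ : Arc E.matrix 0F 1F
      a₀₁ = arc E.one-arc
      a₁₂ : Arc E.matrix 1F 2F
      a₁₂ = arc E.one-arc
      a₂₃ : Arc E.matrix 2F 3F
      a₂₃ = arc E.one-arc
      a₃₄ : Arc E.matrix 3F 4F
      a₃₄ = arc E.one-arc
      from : ∀ i → Star (Arc E.matrix) 0F i
      from 0F = ε
      from 1F = a₀₁ ◅ ε
      from 2F = a₀₁ ◅ a₁₂ ◅ ε
      from 3F = a₀₁ ◅ a₁₂ ◅ a₂₃ ◅ ε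
      from 4F = a₀₁ ◅ a₁₂ ◅ a₂₃ ◅ a₃₄ ◅ ε
      irreducible : ¬ (g ≈ 0#) ⊎ ¬ (q ≈ 0#) × ¬ (f ≈ 0#) → Irreducible E.matrix
      irreducible (inj₁ g≉0) = stronglyConnected⇒irreducible E.matrix 0F to from
        where
        a₄₀ : Arc E.matrix 4F 0F
        a₄₀ = arc (E.var-arc 4 g≉0)
        to : ∀ i → Star (Arc E.matrix) i 0F
        to 0F = ε
        to 1F = a₁₂ ◅ a₂₃ ◅ a₃₄ ◅ a₄₀ ◅ ε
        to 2F = a₂₃ ◅ a₃₄ ◅ a₄₀ ◅ ε
        to 3F = a₃₄ ◅ a₄₀ ◅ ε
        to 4F = a₄₀ ◅ ε
      irreducible (inj₂ (q≉0 , f≉0)) = stronglyConnected⇒irreducible E.matrix 0F to from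
        where
        a₃₀ : Arc E.matrix 3F 0F
        a₃₀ = arc (E.var-arc 3 f≉0)
        a₄₂ : Arc E.matrix 4F 2F
        a₄₂ = arc (E.var-arc 2 q≉0)
        to : ∀ i → Star (Arc E.matrix) i 0F
        to 0F = ε
        to 1F = a₁₂ ◅ a₂₃ ◅ a₃₀ ◅ ε
        to 2F = a₂₃ ◅ a₃₀ ◅ ε
        to 3F = a₃₀ ◅ ε
        to 4F = a₄₂ ◅ a₂₃ ◅ a₃₀ ◅ ε

  module _ {α b φ : Carrier} (0≤α : 0# ≤ α) (0≤b : 0# ≤ b) (0≤φ : 0# ≤ φ) (φ≉0 : ¬ (φ ≈ 0#)) where
    private
      module E = Evaluated (α ▷ b ▷ φ ▷ ∅)
        (env-nonNeg 0≤α (env-nonNeg 0≤b (env-nonNeg 0≤φ ∅-nonNeg))) bipartite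

    -- For q = g = 0 the polynomial is x times a quartic realized on a 4-cycle. Doubling vertex 0
    -- supplies the eigenvalue 0 without an isolated vertex: the difference of the twins lies in the
    -- kernel.
    bipartite-matrix : IrreducibleMatrix (quintic (- (α + α + b)) 0# ((α + α) * b - (φ + φ)) 0#)
    bipartite-matrix = E.matrix , E.matrix-nonNeg _ , stronglyConnected⇒irreducible E.matrix 3F to from ,
      E.matrix-coeffs bipartite-coeffs bipartite-matches
      where
      a₀₁ : Arc E.matrix 0F 1F
      a₀₁ = arc E.one-arc
      a₄₁ : Arc E.matrix 4F 1F
      a₄₁ = arc E.one-arc
      a₁₂ : Arc E.matrix 1F 2F
      a₁₂ = arc E.one-arc
      a₂₃ : Arc E.matrix 2F 3F
      a₂₃ = arc E.one-arc
      a₃₀ : Arc E.matrix 3F 0F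
      a₃₀ = arc (E.var-arc 2 φ≉0)
      a₃₄ : Arc E.matrix 3F 4F
      a₃₄ = arc (E.var-arc 2 φ≉0)
      to : ∀ i → Star (Arc E.matrix) i 3F
      to 0F = a₀₁ ◅ a₁₂ ◅ a₂₃ ◅ ε
      to 1F = a₁₂ ◅ a₂₃ ◅ ε
      to 2F = a₂₃ ◅ ε
      to 3F = ε
      to 4F = a₄₁ ◅ a₁₂ ◅ a₂₃ ◅ ε
      from : ∀ i → Star (Arc E.matrix) 3F i
      from 0F = a₃₀ ◅ ε
      from 1F = a₃₀ ◅ a₀₁ ◅ ε
      from 2F = a₃₀ ◅ a₀₁ ◅ a₁₂ ◅ ε
      from 3F = ε
      from 4F = a₃₄ ◅ ε

  module _ {a τ : Carrier} (0≤a : 0# ≤ a) (0≤τ : 0# ≤ τ) (τ≉0 : ¬ (τ ≈ 0#)) where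
    private
      module E = Evaluated (a ▷ τ ▷ ∅) (env-nonNeg 0≤a (env-nonNeg 0≤τ ∅-nonNeg)) bowtie

    -- For a = b the two 2-cycles tie, so the 3-cycle weight can be shared between two triangles
    -- without lowering E = a q. The triangles join the blocks and create neither 4-cycles nor
    -- 5-cycles.
    bowtie-matrix : IrreducibleMatrix (quintic (- (a + a)) (- (τ + τ)) (a * a) (a * (τ + τ)))
    bowtie-matrix = E.matrix , E.matrix-nonNeg _ , stronglyConnected⇒irreducible E.matrix 4F to from ,
      E.matrix-coeffs bowtie-coeffs bowtie-matches
      where
      a₀₁ : Arc E.matrix 0F 1F
      a₀₁ = arc E.one-arc
      a₁₄ : Arc E.matrix 1F 4F
      a₁₄ = arc E.one-arc
      a₂₃ : Arc E.matrix 2F 3F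
      a₂₃ = arc E.one-arc
      a₃₄ : Arc E.matrix 3F 4F
      a₃₄ = arc E.one-arc
      a₄₀ : Arc E.matrix 4F 0F
      a₄₀ = arc (E.var-arc 1 τ≉0)
      a₄₂ : Arc E.matrix 4F 2F
      a₄₂ = arc (E.var-arc 1 τ≉0)
      to : ∀ i → Star (Arc E.matrix) i 4F
      to 0F = a₀₁ ◅ a₁₄ ◅ ε
      to 1F = a₁₄ ◅ ε
      to 2F = a₂₃ ◅ a₃₄ ◅ ε
      to 3F = a₃₄ ◅ ε
      to 4F = ε
      from : ∀ i → Star (Arc E.matrix) 4F i
      from 0F = a₄₀ ◅ ε
      from 1F = a₄₀ ◅ a₀₁ ◅ ε
      from 2F = a₄₂ ◅ ε
      from 3F = a₄₂ ◅ a₂₃ ◅ ε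
      from 4F = ε

-- Translation between the factorization and the three cases

module Cases {c ℓ₁ ℓ₂} (ℝ : Reals c ℓ₁ ℓ₂) where
  open Reals ℝ
  open OrderedField ℝ
  open Realizability ℝ using (quintic; Case1; Case2; Case3)
  open Necessity ℝ
  open Obstruction ℝ
  open Construction ℝ
  open import Relation.Binary.Reasoning.Setoid setoid

  /-unique : ∀ {x y d} → ¬ (d ≈ 0#) → x ≈ y * d → x / d ≈ y
  /-unique {x} {y} {d} d≉0 x≈yd = begin
    x * d ⁻¹          ≈⟨ *-congʳ x≈yd ⟩
    y * d * d ⁻¹      ≈⟨ solve (y ▷ d ▷ d ⁻¹ ▷ ∅) (v₀ :* v₁ :* v₂) (v₀ :* (v₁ :* v₂)) refl ⟩
    y * (d * d ⁻¹)    ≈⟨ *-congˡ (*-inverseʳ d d≉0) ⟩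
    y * 1#            ≈⟨ *-identityʳ y ⟩
    y                 ∎

  4≉0 : ¬ (4# ≈ 0#)
  4≉0 = double≉0 2≉0

  half-quarter : ∀ {x h} → x ≈ h + h → x / 2# ≈ h × (x * x) / 4# ≈ h * h
  half-quarter {x} {h} x≈2h =
    /-unique 2≉0 (trans x≈2h (solve (h ▷ ∅) (v₀ :+ v₀) (v₀ :* (:1 :+ :1)) refl)) ,
    /-unique 4≉0 (trans (*-cong x≈2h x≈2h)
      (solve (h ▷ ∅) ((v₀ :+ v₀) :* (v₀ :+ v₀)) (v₀ :* v₀ :* ((:1 :+ :1) :+ (:1 :+ :1))) refl))

  -‿≉0 : ∀ {x} → ¬ (x ≈ 0#) → ¬ (- x ≈ 0#)
  -‿≉0 {x} x≉0 -x≈0 = x≉0 (trans (solve (x ▷ ∅) v₀ (:- :- v₀) refl) (trans (-‿cong -x≈0) -0≈0))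

  negative : ∀ {x k} → 0# ≤ x → ¬ (x ≈ 0#) → k ≈ - x → k < 0#
  negative {x} {k} 0≤x x≉0 k≈-x =
    0≤-⇒≤ (≤-respʳ-≈ (trans (solve (x ▷ ∅) v₀ (:0 ⊟ :- v₀) refl) (+-congˡ (-‿cong (sym k≈-x)))) 0≤x) ,
    λ k≈0 → -‿≉0 x≉0 (trans (sym k≈-x) k≈0)

  <0⇒0≤- : ∀ {k} → k < 0# → 0# ≤ - k
  <0⇒0≤- (k≤0 , _) = ≤-respʳ-≈ (+-identityˡ _) (≤⇒0≤- k≤0)

  quintic-cong : ∀ {k₂ k₃ k₄ k₅ l₂ l₃ l₄ l₅} → k₂ ≈ l₂ → k₃ ≈ l₃ → k₄ ≈ l₄ → k₅ ≈ l₅ → ∀ i →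
    Polynomials.coeff rawRing (quintic k₂ k₃ k₄ k₅) i ≈ Polynomials.coeff rawRing (quintic l₂ l₃ l₄ l₅) i
  quintic-cong e₂ e₃ e₄ e₅ 0 = e₅
  quintic-cong e₂ e₃ e₄ e₅ 1 = e₄
  quintic-cong e₂ e₃ e₄ e₅ 2 = e₃
  quintic-cong e₂ e₃ e₄ e₅ 3 = e₂
  quintic-cong e₂ e₃ e₄ e₅ 4 = ≈-refl
  quintic-cong e₂ e₃ e₄ e₅ 5 = ≈-refl
  quintic-cong e₂ e₃ e₄ e₅ (suc (suc (suc (suc (suc (suc _)))))) = ≈-refl

  respects : ∀ {k₂ k₃ k₄ k₅ l₂ l₃ l₄ l₅} → IrreducibleMatrix (quintic l₂ l₃ l₄ l₅) →
             k₂ ≈ l₂ → k₃ ≈ l₃ → k₄ ≈ l₄ → k₅ ≈ l₅ → IrreducibleMatrix (quintic k₂ k₃ k₄ k₅)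
  respects (A , 0≤A , irr , coeffs) e₂ e₃ e₄ e₅ =
    A , 0≤A , irr , λ i → trans (coeffs i) (sym (quintic-cong e₂ e₃ e₄ e₅ i))

  AnyCase : (k₂ k₃ k₄ k₅ : Carrier) → Set (c ⊔ ℓ₁ ⊔ ℓ₂)
  AnyCase k₂ k₃ k₄ k₅ = Case1 k₂ k₃ k₄ k₅ ⊎ Case2 k₂ k₃ k₄ k₅ ⊎ Case3 k₂ k₃ k₄ k₅

  module FromFactors {k₂ k₃ k₄ k₅ : Carrier} (F : Factors k₂ k₃ k₄ k₅) where
    open Factors F

    -- Here a = σ + r and b = σ - r with σ = -k₂/2. For f = 0 these are the roots of y² + k₂ y + k₄,
    -- and `r` is the square root that occurs in case 2.
    u v σ r : Carrier
    u = a * ½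
    v = b * ½
    σ = u + v
    r = u - v

    0≤r : 0# ≤ r
    0≤r = ≤-respʳ-≈ (solve (a ▷ b ▷ ½ ▷ ∅) ((v₀ ⊟ v₁) :* v₂) (v₀ :* v₂ ⊟ v₁ :* v₂) refl) (*-nonNeg b≤a 0≤½)

    r+r : r + r ≈ a - b
    r+r = trans (solve (u ▷ v ▷ ∅) ((v₀ ⊟ v₁) :+ (v₀ ⊟ v₁)) ((v₀ :+ v₀) ⊟ (v₁ :+ v₁)) refl)
                (+-cong (halves a) (-‿cong (halves b)))

    k₂≈-σ-σ : k₂ ≈ - σ + - σ
    k₂≈-σ-σ = trans k₂≈ (trans (-‿cong (sym (+-cong (halves a) (halves b))))
      (solve (u ▷ v ▷ ∅) (:- ((v₀ :+ v₀) :+ (v₁ :+ v₁))) (:- (v₀ :+ v₁) :+ :- (v₀ :+ v₁)) refl))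

    discriminant : f ≈ 0# → (k₂ * k₂) / 4# - k₄ ≈ r * r
    discriminant f≈0 = begin
      (k₂ * k₂) / 4# - k₄             ≈⟨ +-cong (proj₂ (half-quarter k₂≈-σ-σ)) (-‿cong (trans k₄≈ (+-cong
                                           (*-cong (sym (halves a)) (sym (halves b))) (-‿cong f≈0)))) ⟩
      - σ * - σ - ((u + u) * (v + v) - 0#)
        ≈⟨ solve (u ▷ v ▷ ∅) ((:- (v₀ :+ v₁)) :* (:- (v₀ :+ v₁)) ⊟ ((v₀ :+ v₀) :* (v₁ :+ v₁) ⊟ :0))
             ((v₀ ⊟ v₁) :* (v₀ ⊟ v₁)) refl ⟩
      r * r                           ∎

    a+b≉0 : ¬ (a ≈ 0#) → ¬ (a + b ≈ 0#)
    a+b≉0 a≉0 a+b≈0 = a≉0 (summandˡ≈0 0≤a 0≤b (≤-reflexive (trans (sym -0≈0) (-‿cong (sym a+b≈0)))))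

    a≉b⇒a≉0 : ¬ (a - b ≈ 0#) → ¬ (a ≈ 0#)
    a≉b⇒a≉0 a≉b a≈0 = a≉b (nonNeg∧nonPos⇒≈0 b≤a (≤-respʳ-≈ (begin
      b              ≈⟨ solve (a ▷ b ▷ ∅) v₁ (v₀ ⊟ (v₀ ⊟ v₁)) refl ⟩
      a - (a - b)    ≈⟨ +-congʳ a≈0 ⟩
      0# - (a - b)   ≈⟨ +-identityˡ _ ⟩
      - (a - b)      ∎) 0≤b))

    x-0≈x : ∀ {x y} → y ≈ 0# → x - y ≈ x
    x-0≈x {x} y≈0 = trans (+-congˡ (trans (-‿cong y≈0) -0≈0)) (+-identityʳ x)

    k₃<0 : ¬ (q ≈ 0#) → k₃ < 0#
    k₃<0 q≉0 = negative 0≤q q≉0 k₃≈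

    case1 : f ≈ 0# → g ≈ 0# → ¬ (q ≈ 0#) → ¬ (a - b ≈ 0#) → b ≈ 0# → Case1 k₂ k₃ k₄ k₅
    case1 f≈0 g≈0 q≉0 a≉b b≈0 = negative (+-nonNeg 0≤a 0≤b) (a+b≉0 (a≉b⇒a≉0 a≉b)) k₂≈ , k₃<0 q≉0 ,
      trans k₄≈ (trans (x-0≈x f≈0) (trans (*-congˡ b≈0) (zeroʳ a))) , (begin
      k₅                  ≈⟨ trans k₅≈ (x-0≈x g≈0) ⟩
      a * q               ≈⟨ *-congʳ (trans (+-congˡ b≈0) (+-identityʳ a)) ⟨
      (a + b) * q         ≈⟨ solve (a + b ▷ q ▷ ∅) (v₀ :* v₁) ((:- v₀) :* (:- v₁)) refl ⟩
      - (a + b) * - q     ≈⟨ *-cong k₂≈ k₃≈ ⟨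
      k₂ * k₃             ∎)

    case2 : f ≈ 0# → g ≈ 0# → ¬ (q ≈ 0#) → ¬ (a - b ≈ 0#) → ¬ (b ≈ 0#) → Case2 k₂ k₃ k₄ k₅
    case2 f≈0 g≈0 q≉0 a≉b b≉0 = negative (+-nonNeg 0≤a 0≤b) (a+b≉0 a≉0) k₂≈ , k₃<0 q≉0 ,
      (≤-respʳ-≈ (sym k₄≈ab) (*-nonNeg 0≤a 0≤b) , λ 0≈k₄ → *-≉0 a≉0 b≉0 (trans (sym k₄≈ab) (sym 0≈k₄))) ,
      (0≤-⇒≤ (≤-respʳ-≈ (sym (discriminant f≈0)) (square-nonNeg r)) , λ k₄≈ →
        r≉0 (square≈0 (trans (sym (discriminant f≈0)) (trans (+-congˡ (-‿cong k₄≈)) (-‿inverseʳ _))))) ,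
      r , (0≤r , sym (discriminant f≈0)) , (begin
        k₅                     ≈⟨ trans k₅≈ (x-0≈x g≈0) ⟩
        a * q                  ≈⟨ *-congʳ (halves a) ⟨
        (u + u) * q            ≈⟨ solve (u ▷ v ▷ q ▷ ∅) ((v₀ :+ v₀) :* v₂)
                                    ((:- v₂) :* (:- (v₀ :+ v₁) ⊟ (v₀ ⊟ v₁))) refl ⟩
        - q * (- σ - r)        ≈⟨ *-cong k₃≈ (+-congʳ (proj₁ (half-quarter k₂≈-σ-σ))) ⟨
        k₃ * (k₂ / 2# - r)     ∎)
      where
      a≉0 : ¬ (a ≈ 0#)
      a≉0 = a≉b⇒a≉0 a≉b
      k₄≈ab : k₄ ≈ a * b
      k₄≈ab = trans k₄≈ (x-0≈x f≈0)
      r≉0 : ¬ (r ≈ 0#)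
      r≉0 r≈0 = a≉b (trans (sym r+r) (trans (+-cong r≈0 r≈0) (+-identityʳ 0#)))

    case3 : f ≈ 0# → g ≈ 0# → q ≈ 0# → a - b ≈ 0# → ¬ (a ≈ 0#) → Case3 k₂ k₃ k₄ k₅
    case3 f≈0 g≈0 q≈0 a≈b a≉0 = negative (+-nonNeg 0≤a 0≤b) (a+b≉0 a≉0) k₂≈ ,
      trans k₃≈ (trans (-‿cong q≈0) -0≈0) ,
      sym (x∙y⁻¹≈ε⇒x≈y _ _ (trans (discriminant f≈0) (trans (*-congʳ r≈0) (zeroˡ r)))) ,
      trans k₅≈ (trans (x-0≈x g≈0) (trans (*-congˡ q≈0) (zeroʳ a)))
      where
      r≈0 : r ≈ 0#
      r≈0 = *-cancelˡ-≈0 2≉0 (trans (solve (r ▷ ∅) ((:1 :+ :1) :* v₀) (v₀ :+ v₀) refl) (trans r+r a≈b))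

    x⁵-case : f ≈ 0# → g ≈ 0# → q ≈ 0# → a - b ≈ 0# → a ≈ 0# → ∀ i →
      Polynomials.coeff rawRing (quintic k₂ k₃ k₄ k₅) i ≈ Polynomials.coeff rawRing (quintic 0# 0# 0# 0#) i
    x⁵-case f≈0 g≈0 q≈0 a≈b a≈0 = quintic-cong
      (trans k₂≈ (trans (-‿cong (trans (+-cong a≈0 b≈0) (+-identityʳ 0#))) -0≈0))
      (trans k₃≈ (trans (-‿cong q≈0) -0≈0))
      (trans k₄≈ (trans (x-0≈x f≈0) (trans (*-congʳ a≈0) (zeroˡ b))))
      (trans k₅≈ (trans (x-0≈x g≈0) (trans (*-congʳ a≈0) (zeroˡ q))))
      where
      b≈0 : b ≈ 0#
      b≈0 = trans (sym (x∙y⁻¹≈ε⇒x≈y a b a≈b)) a≈0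

    hamiltonian-case : ¬ (g ≈ 0#) ⊎ ¬ (q ≈ 0#) × ¬ (f ≈ 0#) → IrreducibleMatrix (quintic k₂ k₃ k₄ k₅)
    hamiltonian-case arcs =
      respects {l₂ = - (a + b)} {l₃ = - q} {l₄ = a * b - f} {l₅ = a * q - g}
        (hamiltonian-matrix 0≤a 0≤b 0≤q 0≤f 0≤g arcs) k₂≈ k₃≈ k₄≈ k₅≈

    k₅≈0 : g ≈ 0# → q ≈ 0# → k₅ ≈ 0#
    k₅≈0 g≈0 q≈0 = trans k₅≈ (trans (x-0≈x g≈0) (trans (*-congˡ q≈0) (zeroʳ a)))

    half≉0 : ∀ {x} → ¬ (x ≈ 0#) → ¬ (x * ½ ≈ 0#)
    half≉0 {x} x≉0 h≈0 = x≉0 (trans (sym (halves x)) (trans (+-cong h≈0 h≈0) (+-identityʳ 0#)))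

    bipartite-case : g ≈ 0# → q ≈ 0# → ¬ (f ≈ 0#) → IrreducibleMatrix (quintic k₂ k₃ k₄ k₅)
    bipartite-case g≈0 q≈0 f≉0 =
      respects {l₂ = - (u + u + b)} {l₃ = 0#} {l₄ = (u + u) * b - (f * ½ + f * ½)} {l₅ = 0#}
        (bipartite-matrix (*-nonNeg 0≤a 0≤½) 0≤b (*-nonNeg 0≤f 0≤½) (half≉0 f≉0))
        (trans k₂≈ (-‿cong (+-congʳ (sym (halves a)))))
        (trans k₃≈ (trans (-‿cong q≈0) -0≈0))
        (trans k₄≈ (+-cong (*-congʳ (sym (halves a))) (-‿cong (sym (halves f)))))
        (k₅≈0 g≈0 q≈0)

    bowtie-case : f ≈ 0# → g ≈ 0# → a - b ≈ 0# → ¬ (q ≈ 0#) → IrreducibleMatrix (quintic k₂ k₃ k₄ k₅)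
    bowtie-case f≈0 g≈0 a-b≈0 q≉0 =
      respects {l₂ = - (a + a)} {l₃ = - (q * ½ + q * ½)} {l₄ = a * a} {l₅ = a * (q * ½ + q * ½)}
        (bowtie-matrix 0≤a (*-nonNeg 0≤q 0≤½) (half≉0 q≉0))
        (trans k₂≈ (-‿cong (+-congˡ (sym a≈b))))
        (trans k₃≈ (-‿cong (sym (halves q))))
        (trans k₄≈ (trans (x-0≈x f≈0) (*-congˡ (sym a≈b))))
        (trans k₅≈ (trans (x-0≈x g≈0) (*-congˡ (sym (halves q)))))
      where
      a≈b : a ≈ b
      a≈b = x∙y⁻¹≈ε⇒x≈y a b a-b≈0

  -- ab = σ² − r², so the weights may be balanced at the price of f = r².
  balanced : ∀ {k₂ k₃ k₄ k₅} (F : Factors k₂ k₃ k₄ k₅) → Factors.f F ≈ 0# → Factors.g F ≈ 0# → Factors.q F ≈ 0# →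
             ∃[ F′ ] Factors.f {k₂} {k₃} {k₄} {k₅} F′ ≈ FromFactors.r F * FromFactors.r F
                   × Factors.g F′ ≈ 0# × Factors.q F′ ≈ 0#
  balanced {k₂} {k₃} {k₄} {k₅} F f≈0 g≈0 q≈0 = record
    { a = σ ; b = σ ; q = 0# ; f = r * r ; g = 0#
    ; 0≤b = +-nonNeg (*-nonNeg 0≤a 0≤½) (*-nonNeg 0≤b 0≤½) ; b≤a = ≤-reflexive (sym (-‿inverseʳ σ))
    ; 0≤q = ≤-refl ; 0≤f = square-nonNeg r ; 0≤g = ≤-refl
    ; k₂≈ = trans k₂≈-σ-σ (solve (σ ▷ ∅) (:- v₀ :+ :- v₀) (:- (v₀ :+ v₀)) refl)
    ; k₃≈ = trans k₃≈ (-‿cong q≈0)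
    ; k₄≈ = trans k₄≈ (trans (+-cong (*-cong (sym (halves a)) (sym (halves b))) (-‿cong f≈0))
        (solve (u ▷ v ▷ ∅) ((v₀ :+ v₀) :* (v₁ :+ v₁) ⊟ :0)
          ((v₀ :+ v₁) :* (v₀ :+ v₁) ⊟ (v₀ ⊟ v₁) :* (v₀ ⊟ v₁)) refl))
    ; k₅≈ = trans (k₅≈0 g≈0 q≈0) (solve (σ ▷ ∅) :0 (v₀ :* :0 ⊟ :0) refl)
    } , ≈-refl , ≈-refl , ≈-refl
    where
    open Factors F
    open FromFactors F

  factors⇒irreducible : ∀ {k₂ k₃ k₄ k₅} → Factors k₂ k₃ k₄ k₅ →
    ¬ (∀ i → Polynomials.coeff rawRing (quintic k₂ k₃ k₄ k₅) i ≈ Polynomials.coeff rawRing (quintic 0# 0# 0# 0#) i) →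
    ¬ AnyCase k₂ k₃ k₄ k₅ → IrreducibleMatrix (quintic k₂ k₃ k₄ k₅)
  factors⇒irreducible {k₂} {k₃} {k₄} {k₅} F P≉x⁵ noCase = by-cases (g ≟ 0#) (f ≟ 0#) (q ≟ 0#) (a - b ≟ 0#) (a ≟ 0#) (b ≟ 0#)
    where
    open Factors F
    open FromFactors F
    by-cases : Dec (g ≈ 0#) → Dec (f ≈ 0#) → Dec (q ≈ 0#) → Dec (a - b ≈ 0#) → Dec (a ≈ 0#) → Dec (b ≈ 0#) →
               IrreducibleMatrix (quintic k₂ k₃ k₄ k₅)
    by-cases (no g≉0)  _         _         _         _         _         = hamiltonian-case (inj₁ g≉0)
    by-cases (yes g≈0) (no f≉0)  (no q≉0)  _         _         _         = hamiltonian-case (inj₂ (q≉0 , f≉0))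
    by-cases (yes g≈0) (no f≉0)  (yes q≈0) _         _         _         = bipartite-case g≈0 q≈0 f≉0
    by-cases (yes g≈0) (yes f≈0) (no q≉0)  (yes a≈b) _         _         = bowtie-case f≈0 g≈0 a≈b q≉0
    by-cases (yes g≈0) (yes f≈0) (no q≉0)  (no a≉b)  _         (yes b≈0) =
      contradiction (inj₁ (case1 f≈0 g≈0 q≉0 a≉b b≈0)) noCase
    by-cases (yes g≈0) (yes f≈0) (no q≉0)  (no a≉b)  _         (no b≉0)  =
      contradiction (inj₂ (inj₁ (case2 f≈0 g≈0 q≉0 a≉b b≉0))) noCase
    by-cases (yes g≈0) (yes f≈0) (yes q≈0) (yes a≈b) (yes a≈0) _         =
      contradiction (x⁵-case f≈0 g≈0 q≈0 a≈b a≈0) P≉x⁵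
    by-cases (yes g≈0) (yes f≈0) (yes q≈0) (yes a≈b) (no a≉0)  _         =
      contradiction (inj₂ (inj₂ (case3 f≈0 g≈0 q≈0 a≈b a≉0))) noCase
    -- P = x (x² - a)(x² - b) belongs to no case. Balancing the weights makes f = r² nonzero, which
    -- connects the bipartite matrix.
    by-cases (yes g≈0) (yes f≈0) (yes q≈0) (no a≉b)  _         _         =
      let (F′ , f′≈ , g′≈0 , q′≈0) = balanced F f≈0 g≈0 q≈0 in
      FromFactors.bipartite-case F′ g′≈0 q′≈0 λ f′≈0 →
        a≉b (trans (sym r+r) (trans (+-cong (square≈0 (trans (sym f′≈) f′≈0)) (square≈0 (trans (sym f′≈) f′≈0)))
                                    (+-identityʳ 0#)))

  module _ {k₂ k₃ k₄ k₅ : Carrier} where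
    private
      κ : Carrier
      κ = k₂ / 2#

      κ+κ : κ + κ ≈ k₂
      κ+κ = halves k₂

      quarter : (k₂ * k₂) / 4# ≈ κ * κ
      quarter = proj₂ (half-quarter (sym κ+κ))

      k₃≈--k₃ : k₃ ≈ - - k₃
      k₃≈--k₃ = solve (k₃ ▷ ∅) v₀ (:- :- v₀) refl

      0≤-κ : k₂ < 0# → 0# ≤ - κ
      0≤-κ k₂<0 = ≤-respʳ-≈ (solve (k₂ ▷ ½ ▷ ∅) ((:- v₀) :* v₁) (:- (v₀ :* v₁)) refl)
        (*-nonNeg (<0⇒0≤- k₂<0) 0≤½)

      κ≉0 : k₂ < 0# → ¬ (κ ≈ 0#)
      κ≉0 (_ , k₂≉0) κ≈0 = k₂≉0 (trans (sym κ+κ) (trans (+-cong κ≈0 κ≈0) (+-identityʳ 0#)))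

    critical₁ : Case1 k₂ k₃ k₄ k₅ → Critical k₂ k₃ k₄ k₅
    critical₁ (k₂<0 , k₃<0 , k₄≈0 , k₅≈) = record
      { a = - k₂ ; b = 0# ; q = - k₃
      ; 0≤a = <0⇒0≤- k₂<0 ; a≉0 = -‿≉0 (proj₂ k₂<0)
      ; b≤a = ≤-respʳ-≈ -k₂≈ (<0⇒0≤- k₂<0) ; 0≤q = <0⇒0≤- k₃<0
      ; k₂≈ = solve (k₂ ▷ ∅) v₀ (:- (:- v₀ :+ :0)) refl
      ; k₃≈ = k₃≈--k₃
      ; k₄≈ = trans k₄≈0 (sym (zeroʳ _))
      ; k₅≈ = trans k₅≈ (solve (k₂ ▷ k₃ ▷ ∅) (v₀ :* v₁) ((:- v₀) :* (:- v₁)) refl)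
      ; boundary = inj₁ (-‿≉0 (proj₂ k₃<0) , λ z → -‿≉0 (proj₂ k₂<0) (trans -k₂≈ z))
      }
      where
      -k₂≈ : - k₂ ≈ - k₂ - 0#
      -k₂≈ = solve (k₂ ▷ ∅) (:- v₀) (:- v₀ ⊟ :0) refl

    -- The larger root of y² + k₂ y + k₄ is `a`; the minus sign before the square root in k₅ singles
    -- it out, because k₃ (κ - r) = (-κ + r)(-k₃).
    critical₂ : Case2 k₂ k₃ k₄ k₅ → Critical k₂ k₃ k₄ k₅
    critical₂ (k₂<0 , k₃<0 , 0<k₄ , (_ , k₄≉) , r , (0≤r , r²≈) , k₅≈) = record
      { a = - κ + r ; b = - κ - r ; q = - k₃
      ; 0≤a = +-nonNeg (0≤-κ k₂<0) 0≤r
      ; a≉0 = λ a≈0 → -‿≉0 (κ≉0 k₂<0) (summandˡ≈0 (0≤-κ k₂<0) 0≤r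
          (≤-reflexive (trans (sym -0≈0) (-‿cong (sym a≈0)))))
      ; b≤a = ≤-respʳ-≈ r+r≈a-b (+-nonNeg 0≤r 0≤r)
      ; 0≤q = <0⇒0≤- k₃<0
      ; k₂≈ = trans (sym κ+κ) (solve (κ ▷ r ▷ ∅) (v₀ :+ v₀) (:- ((:- v₀ :+ v₁) :+ (:- v₀ ⊟ v₁))) refl)
      ; k₃≈ = k₃≈--k₃
      ; k₄≈ = begin
          k₄                                    ≈⟨ solve (k₄ ▷ (k₂ * k₂) / 4# ▷ ∅) v₀ (v₁ ⊟ (v₁ ⊟ v₀)) refl ⟩
          (k₂ * k₂) / 4# - ((k₂ * k₂) / 4# - k₄) ≈⟨ +-cong quarter (-‿cong (sym r²≈)) ⟩
          κ * κ - r * r                         ≈⟨ solve (κ ▷ r ▷ ∅) (v₀ :* v₀ ⊟ v₁ :* v₁)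
                                                     ((:- v₀ :+ v₁) :* (:- v₀ ⊟ v₁)) refl ⟩
          (- κ + r) * (- κ - r)                 ∎
      ; k₅≈ = trans k₅≈ (solve (κ ▷ r ▷ k₃ ▷ ∅) (v₂ :* (v₀ ⊟ v₁)) ((:- v₀ :+ v₁) :* (:- v₂)) refl)
      ; boundary = inj₁ (-‿≉0 (proj₂ k₃<0) , λ z → double≉0 r≉0 (trans r+r≈a-b z))
      }
      where
      r+r≈a-b : r + r ≈ - κ + r - (- κ - r)
      r+r≈a-b = solve (κ ▷ r ▷ ∅) (v₁ :+ v₁) (:- v₀ :+ v₁ ⊟ (:- v₀ ⊟ v₁)) refl
      r≉0 : ¬ (r ≈ 0#)
      r≉0 r≈0 = k₄≉ (sym (x∙y⁻¹≈ε⇒x≈y _ _ (trans (sym r²≈) (trans (*-congʳ r≈0) (zeroˡ r)))))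

    critical₃ : Case3 k₂ k₃ k₄ k₅ → Critical k₂ k₃ k₄ k₅
    critical₃ (k₂<0 , k₃≈0 , k₄≈ , k₅≈0) = record
      { a = - κ ; b = - κ ; q = 0#
      ; 0≤a = 0≤-κ k₂<0 ; a≉0 = -‿≉0 (κ≉0 k₂<0)
      ; b≤a = ≤-reflexive (sym (-‿inverseʳ (- κ))) ; 0≤q = ≤-refl
      ; k₂≈ = trans (sym κ+κ) (solve (κ ▷ ∅) (v₀ :+ v₀) (:- (:- v₀ :+ :- v₀)) refl)
      ; k₃≈ = trans k₃≈0 (sym -0≈0)
      ; k₄≈ = trans k₄≈ (trans quarter (solve (κ ▷ ∅) (v₀ :* v₀) ((:- v₀) :* (:- v₀)) refl))
      ; k₅≈ = trans k₅≈0 (sym (zeroʳ _))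
      ; boundary = inj₂ (≈-refl , ≈-refl)
      }

    anyCase⇒critical : AnyCase k₂ k₃ k₄ k₅ → Critical k₂ k₃ k₄ k₅
    anyCase⇒critical (inj₁ h)        = critical₁ h
    anyCase⇒critical (inj₂ (inj₁ h)) = critical₂ h
    anyCase⇒critical (inj₂ (inj₂ h)) = critical₃ h

theorem26 : ∀ {c ℓ₁ ℓ₂} (ℝ : Reals c ℓ₁ ℓ₂) →
    let open Reals ℝ using (Carrier)
        open Realizability ℝ
    in (k₂ k₃ k₄ k₅ : Carrier) →
       let P = quintic k₂ k₃ k₄ k₅
           AnyCase = Case1 k₂ k₃ k₄ k₅ ⊎ Case2 k₂ k₃ k₄ k₅ ⊎ Case3 k₂ k₃ k₄ k₅
       in ¬ (P ≈ₚ x⁵) →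
          (¬ AnyCase → (Realizable 5 P ⇔ IrreduciblyRealizable 5 P)) ×
          (AnyCase → ¬ IrreduciblyRealizable 5 P)
theorem26 ℝ k₂ k₃ k₄ k₅ P≉x⁵ =
  (λ noCase → mk⇔
    (λ r → seal-irreducible 5 P (factors⇒irreducible (realizable⇒factors r) P≉x⁵ noCase))
    (irreduciblyRealizable⇒realizable 5 P)) ,
  λ anyCase → critical⇒¬irreduciblyRealizable (anyCase⇒critical anyCase)
  where
  open Necessity ℝ
  open Obstruction ℝ
  open Cases ℝ
  P = Realizability.quintic ℝ k₂ k₃ k₄ k₅
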